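{- Let $k\geq 2$, let $G_l(q)$ ($l\geq 1$) and ${}^J_ih^{(j)}_1(q)$ be as in the context. Then for every $J\geq 0$ and every $i\in\{1,\dots,k\}$ the limit $\lim_{j\to\infty}{}^J_ih^{(j)}_1(q)$ exists, and $$G_{(k-1)J+i}(q)=\lim_{j\to\infty}{}^J_ih^{(j)}_1(q).$$
   Context: $q$ is a formal variable. Fix an integer $k\geq 2$. For $1\leq i\leq k$ define $$G_i(q)=\prod_{\substack{m\geq 1,\ m\not\equiv 2\ (\mathrm{mod}\ 4),\\ m\not\equiv 0,\ 2k+(2i-1),\ 2k-(2i-1)\ (\mathrm{mod}\ 4k)}}(1-q^m)^{ -1}.$$ Every integer $l\geq k+1$ can be written uniquely as $l=(k-1)j+i$ with $j\geq 1$ and $2\leq i\leq k$ (note $(k-1)j+1=(k-1)(j-1)+k$). For such $l$ define recursively $$G_{(k-1)j+i}(q)=\frac{G_{(k-1)(j-1)+k-i+1}(q)-G_{(k-1)(j-1)+k-i+2}(q)}{q^{2j(i-1)}}-q^{ -1}G_{(k-1)j+i-1}(q).$$ For each $j\geq 1$ let $\mathbf{A}'_{(j)}$ be the $k\times k$ matrix with $(r,c)$ entry $[c\leq k-r+1]\,q^{2j(c-1)}+[c\leq k-r]\,q^{2jc-1}$ ($[P]$ is $1$ if $P$ holds, $0$ otherwise). For an integer $J\geq 0$ let ${}^J\mathbf{h}^{(J)}$ be the identity matrix and ${}^J\mathbf{h}^{(j)}=\mathbf{A}'_{(J+1)}\cdots\mathbf{A}'_{(j)}$ for $j>J$; let ${}^J_ih^{(j)}_l(q)$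 be its $(i,l)$ entry. A sequence $H_j(q)$ of formal power series has a limit if for every $t\geq 0$ the coefficient of $q^t$ in $H_j(q)$ is independent of $j$ for all sufficiently large $j$; the limit is the power series whose coefficient of $q^t$ is this stable value. -}

module Defs where

open import Data.Nat as ℕ using (ℕ; zero; suc; _∸_; _≤ᵇ_; _≡ᵇ_)
open import Data.Nat.DivMod using (_%_; _/_)
open import Data.Nat.Divisibility using (_∣?_)
open import Data.Integer as ℤ using (ℤ; +_; -[1+_])
open import Data.Bool using (Bool; true; false; if_then_else_; _∧_; not)
open import Relation.Nullary using (does)
open import Data.Product using (∃)
open import Relation.Binary.PropositionalEquality using (_≡_)

-- Formal power series in q over ℤ: coefficient functions (coefficient of q^n).
PS : Set
PS = ℕ → ℤ

-- Formal Laurent series in q over ℤ: coefficient functions on ℤ.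
LS : Set
LS = ℤ → ℤ

sumTo : ℕ → (ℕ → ℤ) → ℤ
sumTo zero    f = f 0
sumTo (suc n) f = sumTo n f ℤ.+ f (suc n)

zeroPS : PS
zeroPS _ = + 0

onePS : PS
onePS zero    = + 1
onePS (suc _) = + 0

_+ₚ_ : PS → PS → PS
(f +ₚ g) n = f n ℤ.+ g n

_*ₚ_ : PS → PS → PS
(f *ₚ g) n = sumTo n (λ a → f a ℤ.* g (n ∸ a))

mono : ℕ → PS
mono e n = if n ≡ᵇ e then + 1 else + 0

-- (1 - q^m)^{-1} = Σ_t q^{m t}   (used for m ≥ 1)
geom : ℕ → PS
geom m n = if does (m ∣? n) then + 1 else + 0

-- m mod n (n = 0 never occurs in uses, k ≥ 2)
modN : ℕ → ℕ → ℕ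
modN m zero    = m
modN m (suc n) = m % suc n

allowed : ℕ → ℕ → ℕ → Bool
allowed k i m =
  not (m ≡ᵇ 0) ∧ not (modN m 4 ≡ᵇ 2)
  ∧ not (r ≡ᵇ 0)
  ∧ not (r ≡ᵇ modN ((2 ℕ.* k) ℕ.+ ((2 ℕ.* i) ∸ 1)) (4 ℕ.* k))
  ∧ not (r ≡ᵇ modN ((2 ℕ.* k) ∸ ((2 ℕ.* i) ∸ 1)) (4 ℕ.* k))
  where r = modN m (4 ℕ.* k)

partialProd : ℕ → ℕ → ℕ → PS
partialProd k i zero    = onePS
partialProd k i (suc N) =
  if allowed k i (suc N) then geom (suc N) *ₚ partialProd k i N else partialProd k i N

-- G_i(q) = infinite product; coefficient of q^n equals that of the
-- finite product over admissible m ≤ n (factors with m > n are ≡ 1 mod q^{n+1}).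
Gbase : ℕ → ℕ → PS
Gbase k i n = partialProd k i n n

embed : PS → LS
embed f (+ n)    = f n
embed f -[1+ n ] = + 0

_-ₗ_ : LS → LS → LS
(F -ₗ G) n = F n ℤ.- G n

divq : ℕ → LS → LS
divq e F n = F (n ℤ.+ + e)

-- Recursively defined G_l.
-- block k j i = G_{(k-1)j+i}  for 1 ≤ i ≤ k.

-- inner k j' b i computes G_{(k-1)j'+i} for j' ≥ 1 given
-- b i = G_{(k-1)(j'-1)+i} (1 ≤ i ≤ k).
inner : ℕ → ℕ → (ℕ → LS) → ℕ → LS
inner k j' b zero          = embed zeroPS   -- unused
inner k j' b (suc zero)    = b k            -- (k-1)j'+1 = (k-1)(j'-1)+k
inner k j' b (suc (suc i')) =
  divq (2 ℕ.* j' ℕ.* (i ∸ 1)) (b ((k ∸ i) ℕ.+ 1) -ₗ b ((k ∸ i) ℕ.+ 2))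
    -ₗ divq 1 (inner k j' b (suc i'))
  where i = suc (suc i')

block : ℕ → ℕ → ℕ → LS
block k zero    i = embed (Gbase k i)
block k (suc j) i = inner k (suc j) (block k j) i

-- G_l for l ≥ 1: l ≤ k is the base case; for l ≥ k+1, l = (k-1)j + i with
-- j ≥ 1, 2 ≤ i ≤ k, i.e. j = (l-2) div (k-1), i = (l-2) mod (k-1) + 2.
-- (k-1 is written suc (k ∸ 2), equal to k-1 since k ≥ 2.)
G : ℕ → ℕ → LS
G k l = if l ≤ᵇ k then block k 0 l
        else block k ((l ∸ 2) / suc (k ∸ 2)) (((l ∸ 2) % suc (k ∸ 2)) ℕ.+ 2)

-- Matrices: k×k matrices of polynomials, indexed 1-based by naturals r, c ∈ {1..k}.
Mat : Set
Mat = ℕ → ℕ → PS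

sumPS : ℕ → (ℕ → PS) → PS
sumPS zero    f = zeroPS
sumPS (suc n) f = sumPS n f +ₚ f (suc n)

matMul : ℕ → Mat → Mat → Mat
matMul k M N r c = sumPS k (λ s → M r s *ₚ N s c)

idMat : Mat
idMat r c = if r ≡ᵇ c then onePS else zeroPS

ind : Bool → PS → PS
ind b f = if b then f else zeroPS

A' : ℕ → ℕ → Mat
A' k j r c = ind (c ≤ᵇ (k ∸ r) ℕ.+ 1) (mono (2 ℕ.* j ℕ.* (c ∸ 1)))
          +ₚ ind (c ≤ᵇ k ∸ r) (mono ((2 ℕ.* j ℕ.* c) ∸ 1))

hprod : ℕ → ℕ → ℕ → Mat
hprod k J zero    = idMat
hprod k J (suc d) = matMul k (hprod k J d) (A' k (J ℕ.+ suc d))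

-- {}^J h^{(j)} for j ≥ J   (the value for j < J is irrelevant for limits)
h : ℕ → ℕ → ℕ → Mat
h k J j = hprod k J (j ∸ J)

IsLimit : (ℕ → PS) → PS → Set
IsLimit H L = ∀ t → ∃ λ N → ∀ j → N ℕ.≤ j → H j t ≡ L t

{-# OPTIONS --safe #-}
-- Let c_n = (−q;q²)_n / (q²;q²)_n and y_n = (−q^{2n+3};q²)_∞ / (q^{2n+2};q²)_∞. For all j ≥ 0 and 1 ≤ i ≤ k,
--   G_{(k−1)j+i} = Σ_{n≥0} (−1)^n c_n y_{n+j} (q^E (1 + q^{2n+2j+1}) − q^D (1 + q^{2n+1})),
-- where E = 2kn² + 2jkn + (2i−1)n and D = E + (2j+4n+2)(k−i) + 2n + 2j + 1. For j = 0 one has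
-- c_n (1 + q^{2n+1}) y_n = F, the product of (1 − q^m)^{−1} over m ≢ 2 (mod 4), so the series is F times a theta series
-- and the formula is the Jacobi triple product. For larger j it follows from the recursion, because both
-- sides of the recursion agree termwise up to a telescoping difference.
-- In particular every G_l is a power series and G_{(k−1)j+1} = 1 + O(q^{2j}). The recursion says that the vectors
-- g_j = (G_{(k−1)j+i})_i satisfy g_{j−1} = A'_{(j)} g_j, hence g_J = h^{(j)} g_j. All columns of h^{(j)} but the first
-- are O(q^{2j}), and so g_J agrees with the first column modulo q^{2j}.

module Submission where

open import Defs
open import Data.Nat using (ℕ; _≤_; _+_; _*_; _∸_)
open import Data.Integer using (+_; -[1+_])
open import Data.Product using (_×_)
open import Relation.Binary.PropositionalEquality using (_≡_)

open import Algebra.Bundles using (CommutativeRing)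
import Algebra.Properties.Semiring.Exp as Exp
import Algebra.Solver.Ring as RingSolver
open import Algebra.Solver.Ring.AlmostCommutativeRing using (_-Raw-AlmostCommutative⟶_; fromCommutativeRing)
open import Algebra.Structures using (IsCommutativeRing)
open import Data.Bool using (Bool; true; false; if_then_else_; not; _∧_)
open import Data.Integer as ℤ using (ℤ)
import Data.Integer.Properties as ℤₚ
import Data.Integer.Solver as ℤSolver
open import Data.Maybe.Base as Maybe using (Maybe)
open import Data.Nat using (zero; suc; _<_; _≡ᵇ_; _≤ᵇ_; z≤n; s≤s)
open import Data.Nat.Divisibility using (_∣?_; _∣0; ∣m∣n⇒∣m+n; ∣m+n∣m⇒∣n; ∣-refl; ∣⇒≤; m∣m*n; n∣m*n)
open import Data.Nat.DivMod using (_%_; _/_; [m+kn]%n≡m%n; m<n⇒m%n≡m; n%n≡0; m%n<n; m≡m%n+[m/n]*n; m∣n⇒o%n%m≡o%m; +-distrib-/-∣ʳ; m*n/n≡m; m<n⇒m/n≡0)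
import Data.Nat.Properties as ℕₚ
open import Data.Nat.Solver using (module +-*-Solver)
open import Data.Nat.Tactic.RingSolver using (solve-∀)
open import Data.Product using (_,_)
open import Function using (_∘_)
open import Level using (0ℓ)
open import Relation.Binary.Bundles using (Setoid)
open import Relation.Binary.PropositionalEquality using (_≢_; refl; sym; trans; cong; cong₂; subst; module ≡-Reasoning)
import Relation.Binary.Reasoning.Setoid as SetoidReasoning
open import Relation.Nullary using (yes; no)
open import Relation.Nullary.Decidable using (dec⇒maybe; dec-true; dec-false)

-- Every telescoping rests on two first-order recurrences, (1 + q^{2m+3}) y_{m+1} = (1 - q^{2m+2})
-- y_m and (1 - q^{2n+2}) c_{n+1} = (1 + q^{2n+1}) c_n. The first moves a piece of a term from level
-- j to level j + 1. The second turns the correction (1 - q^{2n}) c_n, which vanishes at n = 0, into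
-- what the terms of level j + 1 leave over at n - 1; so no boundary contribution survives. With l =
-- i - 1 and m = k - i the reflection i ↦ k - i + 1 of the recursion is the exchange of l and m, and
-- truncated subtraction disappears. The recursion is used multiplied out, among power series;
-- Laurent series enter only when the result is compared with `G`. The index (k-1)j + k = (k-1)(j+1)
-- + 1 lies in two blocks, and the agreement of its two series needs a telescoping of its own.
-- Infinite products other than `F` are replaced by finite ones and congruences. The triple product
-- is the limit of a finite identity whose Gaussian binomials carry an extra factor (P;P)_M, which
-- makes them products without denominators.

odd even : ℕ → ℕ
odd  s = suc (s + s)
even s = suc s + suc s

-- The exponents in the n-th term of the series for G_{(k−1)j+i}, where i = l + 1 and k = l + m + 1.
E D : ℕ → ℕ → ℕ → ℕ → ℕ
E j l m n = 2 * suc (l + m) * (n * n) + 2 * j * suc (l + m) * n + (2 * l + 1) * n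
D j l m n = E j l m n + (2 * j + 4 * n + 2) * m + odd (n + j)

-- The exponent 2j′(i−1) − 1 of the recursion for G_{(k−1)j′+i}, where j′ = j + 1 and i = a + 2.
lead : ℕ → ℕ → ℕ
lead j a = 2 * j * suc a + odd a

-- Arithmetic of the exponents

module Exponents where
  open +-*-Solver

  private
    :odd : ∀ {v} → Polynomial v → Polynomial v
    :odd s = con 1 :+ (s :+ s)

    :suc : ∀ {v} → Polynomial v → Polynomial v
    :suc s = con 1 :+ s

    :E :D : ∀ {v} → Polynomial v → Polynomial v → Polynomial v → Polynomial v → Polynomial v
    :E j l m n = con 2 :* :suc (l :+ m) :* (n :* n) :+ con 2 :* j :* :suc (l :+ m) :* n :+ (con 2 :* l :+ con 1) :* n
    :D j l m n = :E j l m n :+ (con 2 :* j :+ con 4 :* n :+ con 2) :* m :+ :odd (n :+ j)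

    :lead : ∀ {v} → Polynomial v → Polynomial v → Polynomial v
    :lead j a = con 2 :* j :* :suc a :+ :odd a

  E-shift : ∀ j a m n → E j (suc m) a n ≡ E j m (suc a) n + (n + n)
  E-shift = solve 4 (λ j a m n → :E j (:suc m) a n := :E j m (:suc a) n :+ (n :+ n)) refl

  D-shift : ∀ j a m n → D j m (suc a) n ≡ D j (suc m) a n + even (n + j)
  D-shift = solve 4 (λ j a m n → :D j m (:suc a) n := :D j (:suc m) a n :+ (:suc (n :+ j) :+ :suc (n :+ j))) refl

  -- Multiplied by the powers of q in the recursion, the leading exponents of level j + 1 land on D
  -- of level j at n, and the subtracted ones on E of level j at n + 1. The shift from n to n + 1 is
  -- the source of the telescoping.
  lead-E₁ : ∀ j a m n → suc (lead j a) + E (suc j) (suc a) m n ≡ D j (suc m) a n + odd n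
  lead-E₁ = solve 4 (λ j a m n → :suc (:lead j a) :+ :E (:suc j) (:suc a) m n := :D j (:suc m) a n :+ :odd n) refl

  lead-E₂ : ∀ j a m n → lead j a + E (suc j) a (suc m) n ≡ D j (suc m) a n
  lead-E₂ = solve 4 (λ j a m n → :lead j a :+ :E (:suc j) a (:suc m) n := :D j (:suc m) a n) refl

  lead-D₁ : ∀ j a m n → suc (lead j a) + D (suc j) (suc a) m n ≡ E j m (suc a) (suc n)
  lead-D₁ = solve 4 (λ j a m n → :suc (:lead j a) :+ :D (:suc j) (:suc a) m n := :E j m (:suc a) (:suc n)) refl

  lead-D₂ : ∀ j a m n → lead j a + D (suc j) a (suc m) n ≡ E j m (suc a) (suc n) + odd (n + suc j)
  lead-D₂ = solve 4 (λ j a m n → :lead j a :+ :D (:suc j) a (:suc m) n := :E j m (:suc a) (:suc n) :+ :odd (n :+ :suc j)) refl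

  E-first : ∀ j l n → E (suc j) 0 l n ≡ E j l 0 n + (n + n)
  E-first = solve 3 (λ j l n → :E (:suc j) (con 0) l n := :E j l (con 0) n :+ (n :+ n)) refl

  D-first : ∀ j l n → D (suc j) 0 l n ≡ E j l 0 (suc n)
  D-first = solve 3 (λ j l n → :D (:suc j) (con 0) l n := :E j l (con 0) (:suc n)) refl

  D-last : ∀ j l n → D j l 0 n ≡ E j l 0 n + odd (n + j)
  D-last = solve 3 (λ j l n → :D j l (con 0) n := :E j l (con 0) n :+ :odd (n :+ j)) refl

  odd+odd : ∀ n j → odd n + odd (n + j) ≡ n + n + even (n + j)
  odd+odd = solve 2 (λ n j → :odd n :+ :odd (n :+ j) := n :+ n :+ (:suc (n :+ j) :+ :suc (n :+ j))) refl

  n≤E : ∀ j l m n → n ≤ E j l m n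
  n≤E j l m n = ℕₚ.≤-trans (ℕₚ.m≤m+n n _) (ℕₚ.≤-reflexive (e j l m n))
    where
    e : ∀ j l m n → n + (2 * suc (l + m) * (n * n) + 2 * j * suc (l + m) * n + 2 * l * n) ≡ E j l m n
    e = solve 4 (λ j l m n → n :+ (con 2 :* :suc (l :+ m) :* (n :* n) :+ con 2 :* j :* :suc (l :+ m) :* n :+ con 2 :* l :* n) := :E j l m n) refl

  n≤D : ∀ j l m n → n ≤ D j l m n
  n≤D j l m n = ℕₚ.≤-trans (n≤E j l m n) (ℕₚ.≤-trans (ℕₚ.m≤m+n _ ((2 * j + 4 * n + 2) * m)) (ℕₚ.m≤m+n _ (odd (n + j))))

  j+j≤E : ∀ j l m n → j + j ≤ E j l m (suc n)
  j+j≤E j l m n = ℕₚ.≤-trans (ℕₚ.m≤m+n (j + j) _) (ℕₚ.≤-reflexive (e j l m n))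
    where
    e : ∀ j l m n → j + j + (2 * suc (l + m) * (suc n * suc n) + 2 * j * (n + (l + m) * suc n) + (2 * l + 1) * suc n) ≡ E j l m (suc n)
    e = solve 4 (λ j l m n → j :+ j :+ (con 2 :* :suc (l :+ m) :* (:suc n :* :suc n) :+ con 2 :* j :* (n :+ (l :+ m) :* :suc n) :+ (con 2 :* l :+ con 1) :* :suc n) := :E j l m (:suc n)) refl

  j+j≤D : ∀ j l m n → j + j ≤ D j l m n
  j+j≤D j l m n = ℕₚ.≤-trans (ℕₚ.+-mono-≤ (ℕₚ.m≤n+m j n) (ℕₚ.m≤n+m j n)) (ℕₚ.≤-trans (ℕₚ.n≤1+n _) (ℕₚ.m≤n+m (odd (n + j)) _))

  E-zero : ∀ j l m → E j l m 0 ≡ 0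
  E-zero = solve 3 (λ j l m → :E j l m (con 0) := con 0) refl

  -- The ratio of consecutive theta terms for `P` = q^{4k} and α = q^{2k+2i-1}; `D-theta` is the
  -- same for β = q^{2k-2i+1}.
  E-theta : ∀ l m n → n * (4 * suc (l + m)) + odd (suc (l + l + m)) + E 0 l m n ≡ E 0 l m (suc n)
  E-theta = solve 3 (λ l m n → n :* (con 4 :* :suc (l :+ m)) :+ :odd (:suc (l :+ l :+ m)) :+ :E (con 0) l m n := :E (con 0) l m (:suc n)) refl

  D-theta : ∀ l m n → suc n * (4 * suc (l + m)) + odd m + D 0 l m n ≡ D 0 l m (suc n)
  D-theta = solve 3 (λ l m n → :suc n :* (con 4 :* :suc (l :+ m)) :+ :odd m :+ :D (con 0) l m n := :D (con 0) l m (:suc n)) refl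

  D-theta-zero : ∀ l m → odd m ≡ D 0 l m 0
  D-theta-zero = solve 2 (λ l m → :odd m := :D (con 0) l m (con 0)) refl

-- The ring of formal power series

infix  4 _≈_
infix  8 ⊖_
infixl 7 _⊛_
infixl 6 _⊕_ _⊝_

-- A record rather than a bare function type, so that f and g can be inferred from f ≈ g.
record _≈_ (f g : PS) : Set where
  constructor mk≈
  field at : ∀ n → f n ≡ g n
open _≈_ public

-- The coefficient homomorphism of the ring solver. The unit of the ring is `const (+ 1)` and not
-- `onePS`, so that constants in solved equations reduce to it.
const : ℤ → PS
const z zero    = z
const z (suc _) = + 0

𝟙 : PS
𝟙 = const (+ 1)

tail : PS → PS
tail f n = f (suc n)

sumTo-cong : ∀ n {f g : ℕ → ℤ} → (∀ a → a ≤ n → f a ≡ g a) → sumTo n f ≡ sumTo n g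
sumTo-cong zero    e = e 0 z≤n
sumTo-cong (suc n) e =
  cong₂ ℤ._+_ (sumTo-cong n (λ a a≤n → e a (ℕₚ.m≤n⇒m≤1+n a≤n))) (e (suc n) ℕₚ.≤-refl)

sumTo-0 : ∀ n → sumTo n (λ _ → + 0) ≡ + 0
sumTo-0 zero    = refl
sumTo-0 (suc n) = trans (ℤₚ.+-identityʳ _) (sumTo-0 n)

sumTo-suc : ∀ n f → sumTo (suc n) f ≡ f 0 ℤ.+ sumTo n (λ a → f (suc a))
sumTo-suc zero    f = refl
sumTo-suc (suc n) f = begin
  sumTo (suc n) f ℤ.+ f (suc (suc n))                         ≡⟨ cong (ℤ._+ f (suc (suc n))) (sumTo-suc n f) ⟩
  f 0 ℤ.+ sumTo n (λ a → f (suc a)) ℤ.+ f (suc (suc n))       ≡⟨ ℤₚ.+-assoc (f 0) _ _ ⟩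
  f 0 ℤ.+ (sumTo n (λ a → f (suc a)) ℤ.+ f (suc (suc n)))     ∎
  where open ≡-Reasoning

-- Peeling off the constant coefficient of the left factor reduces the ring laws to inductions on
-- the index of the coefficient.
*ₚ-suc : ∀ f g n → (f *ₚ g) (suc n) ≡ f 0 ℤ.* g (suc n) ℤ.+ (tail f *ₚ g) n
*ₚ-suc f g n = sumTo-suc n _

*ₚ-sucʳ : ∀ f g n → (f *ₚ g) (suc n) ≡ (f *ₚ tail g) n ℤ.+ f (suc n) ℤ.* g 0
*ₚ-sucʳ f g n = cong₂ ℤ._+_
  (sumTo-cong n (λ a a≤n → cong (λ x → f a ℤ.* g x) (ℕₚ.+-∸-assoc 1 a≤n)))
  (cong (λ x → f (suc n) ℤ.* g x) (ℕₚ.n∸n≡0 n))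

-- The hypotheses are bounded by n so that this yields congruence both for `_≈_` and for equality
-- modulo a power of q.
*ₚ-cong-at : ∀ n {f f′ g g′ : PS} → (∀ a → a ≤ n → f a ≡ f′ a) → (∀ a → a ≤ n → g a ≡ g′ a) →
            (f *ₚ g) n ≡ (f′ *ₚ g′) n
*ₚ-cong-at n e d = sumTo-cong n (λ a a≤n → cong₂ ℤ._*_ (e a a≤n) (d (n ∸ a) (ℕₚ.m∸n≤m n a)))

*ₚ-comm-at : ∀ n f g → (f *ₚ g) n ≡ (g *ₚ f) n
*ₚ-comm-at zero    f g = ℤₚ.*-comm (f 0) (g 0)
*ₚ-comm-at (suc n) f g = begin
  (f *ₚ g) (suc n)                           ≡⟨ *ₚ-suc f g n ⟩
  f 0 ℤ.* g (suc n) ℤ.+ (tail f *ₚ g) n      ≡⟨ cong₂ ℤ._+_ (ℤₚ.*-comm (f 0) _) (*ₚ-comm-at n (tail f) g) ⟩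
  g (suc n) ℤ.* f 0 ℤ.+ (g *ₚ tail f) n      ≡⟨ ℤₚ.+-comm (g (suc n) ℤ.* f 0) _ ⟩
  (g *ₚ tail f) n ℤ.+ g (suc n) ℤ.* f 0      ≡⟨ *ₚ-sucʳ g f n ⟨
  (g *ₚ f) (suc n)                           ∎
  where open ≡-Reasoning

*ₚ-distribʳ-at : ∀ n h f g → ((f +ₚ g) *ₚ h) n ≡ (f *ₚ h) n ℤ.+ (g *ₚ h) n
*ₚ-distribʳ-at zero    h f g = ℤₚ.*-distribʳ-+ (h 0) (f 0) (g 0)
*ₚ-distribʳ-at (suc n) h f g = begin
  ((f +ₚ g) *ₚ h) (suc n)
    ≡⟨ *ₚ-suc (f +ₚ g) h n ⟩
  (f 0 ℤ.+ g 0) ℤ.* h (suc n) ℤ.+ ((tail f +ₚ tail g) *ₚ h) n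
    ≡⟨ cong₂ ℤ._+_ (ℤₚ.*-distribʳ-+ (h (suc n)) (f 0) (g 0)) (*ₚ-distribʳ-at n h (tail f) (tail g)) ⟩
  (a ℤ.+ b) ℤ.+ (c ℤ.+ d)
    ≡⟨ solve 4 (λ a b c d → (a :+ b) :+ (c :+ d) := (a :+ c) :+ (b :+ d)) refl a b c d ⟩
  (a ℤ.+ c) ℤ.+ (b ℤ.+ d)
    ≡⟨ cong₂ ℤ._+_ (*ₚ-suc f h n) (*ₚ-suc g h n) ⟨
  (f *ₚ h) (suc n) ℤ.+ (g *ₚ h) (suc n) ∎
  where
  open ≡-Reasoning
  open ℤSolver.+-*-Solver
  a = f 0 ℤ.* h (suc n)
  b = g 0 ℤ.* h (suc n)
  c = (tail f *ₚ h) n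
  d = (tail g *ₚ h) n

scale-*ₚ-at : ∀ n z f g → ((λ a → z ℤ.* f a) *ₚ g) n ≡ z ℤ.* (f *ₚ g) n
scale-*ₚ-at zero    z f g = ℤₚ.*-assoc z (f 0) (g 0)
scale-*ₚ-at (suc n) z f g = begin
  ((λ a → z ℤ.* f a) *ₚ g) (suc n)
    ≡⟨ *ₚ-suc (λ a → z ℤ.* f a) g n ⟩
  z ℤ.* f 0 ℤ.* g (suc n) ℤ.+ ((λ a → z ℤ.* tail f a) *ₚ g) n
    ≡⟨ cong₂ ℤ._+_ (ℤₚ.*-assoc z (f 0) _) (scale-*ₚ-at n z (tail f) g) ⟩
  z ℤ.* (f 0 ℤ.* g (suc n)) ℤ.+ z ℤ.* (tail f *ₚ g) n
    ≡⟨ ℤₚ.*-distribˡ-+ z (f 0 ℤ.* g (suc n)) ((tail f *ₚ g) n) ⟨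
  z ℤ.* (f 0 ℤ.* g (suc n) ℤ.+ (tail f *ₚ g) n)
    ≡⟨ cong (z ℤ.*_) (*ₚ-suc f g n) ⟨
  z ℤ.* (f *ₚ g) (suc n) ∎
  where open ≡-Reasoning

*ₚ-assoc-at : ∀ n f g h → ((f *ₚ g) *ₚ h) n ≡ (f *ₚ (g *ₚ h)) n
*ₚ-assoc-at zero    f g h = ℤₚ.*-assoc (f 0) (g 0) (h 0)
*ₚ-assoc-at (suc n) f g h = begin
  ((f *ₚ g) *ₚ h) (suc n)
    ≡⟨ *ₚ-suc (f *ₚ g) h n ⟩
  f 0 ℤ.* g 0 ℤ.* h (suc n) ℤ.+ (tail (f *ₚ g) *ₚ h) n
    ≡⟨ cong (λ x → f 0 ℤ.* g 0 ℤ.* h (suc n) ℤ.+ x) (*ₚ-cong-at n {g = h} (λ a _ → *ₚ-suc f g a) (λ _ _ → refl)) ⟩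
  f 0 ℤ.* g 0 ℤ.* h (suc n) ℤ.+ (((λ a → f 0 ℤ.* tail g a) +ₚ (tail f *ₚ g)) *ₚ h) n
    ≡⟨ cong₂ ℤ._+_ (ℤₚ.*-assoc (f 0) (g 0) _) (*ₚ-distribʳ-at n h (λ a → f 0 ℤ.* tail g a) (tail f *ₚ g)) ⟩
  f 0 ℤ.* (g 0 ℤ.* h (suc n)) ℤ.+ (((λ a → f 0 ℤ.* tail g a) *ₚ h) n ℤ.+ ((tail f *ₚ g) *ₚ h) n)
    ≡⟨ cong (λ x → f 0 ℤ.* (g 0 ℤ.* h (suc n)) ℤ.+ x) (cong₂ ℤ._+_ (scale-*ₚ-at n (f 0) (tail g) h) (*ₚ-assoc-at n (tail f) g h)) ⟩
  f 0 ℤ.* (g 0 ℤ.* h (suc n)) ℤ.+ (f 0 ℤ.* (tail g *ₚ h) n ℤ.+ (tail f *ₚ (g *ₚ h)) n)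
    ≡⟨ ℤₚ.+-assoc (f 0 ℤ.* (g 0 ℤ.* h (suc n))) _ _ ⟨
  f 0 ℤ.* (g 0 ℤ.* h (suc n)) ℤ.+ f 0 ℤ.* (tail g *ₚ h) n ℤ.+ (tail f *ₚ (g *ₚ h)) n
    ≡⟨ cong (ℤ._+ (tail f *ₚ (g *ₚ h)) n) (ℤₚ.*-distribˡ-+ (f 0) (g 0 ℤ.* h (suc n)) ((tail g *ₚ h) n)) ⟨
  f 0 ℤ.* (g 0 ℤ.* h (suc n) ℤ.+ (tail g *ₚ h) n) ℤ.+ (tail f *ₚ (g *ₚ h)) n
    ≡⟨ cong (λ x → f 0 ℤ.* x ℤ.+ (tail f *ₚ (g *ₚ h)) n) (*ₚ-suc g h n) ⟨
  f 0 ℤ.* (g *ₚ h) (suc n) ℤ.+ (tail f *ₚ (g *ₚ h)) n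
    ≡⟨ *ₚ-suc f (g *ₚ h) n ⟨
  (f *ₚ (g *ₚ h)) (suc n) ∎
  where open ≡-Reasoning

zero-*ₚ-at : ∀ n g → (zeroPS *ₚ g) n ≡ + 0
zero-*ₚ-at n g = trans (sumTo-cong n (λ a _ → ℤₚ.*-zeroˡ (g (n ∸ a)))) (sumTo-0 n)

const-*ₚ-at : ∀ n z g → (const z *ₚ g) n ≡ z ℤ.* g n
const-*ₚ-at zero    z g = refl
const-*ₚ-at (suc n) z g = trans (*ₚ-suc (const z) g n)
  (trans (cong (λ x → z ℤ.* g (suc n) ℤ.+ x) (zero-*ₚ-at n g)) (ℤₚ.+-identityʳ (z ℤ.* g (suc n))))

-- Opaque, so that the arguments of an operation can be inferred from its value.
opaque
  _⊕_ _⊛_ : PS → PS → PS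
  f ⊕ g = f +ₚ g
  f ⊛ g = f *ₚ g

  ⊖_ : PS → PS
  (⊖ f) n = ℤ.- f n

_⊝_ : PS → PS → PS
f ⊝ g = f ⊕ ⊖ g

opaque
  unfolding _⊕_ _⊛_ ⊖_

  ⊕-at : ∀ f g n → (f ⊕ g) n ≡ f n ℤ.+ g n
  ⊕-at f g n = refl

  ⊝-at : ∀ f g n → (f ⊝ g) n ≡ f n ℤ.+ ℤ.- g n
  ⊝-at f g n = refl

  ⊛-at : ∀ f g n → (f ⊛ g) n ≡ (f *ₚ g) n
  ⊛-at f g n = refl

  PS-isCommutativeRing : IsCommutativeRing _≈_ _⊕_ _⊛_ ⊖_ zeroPS 𝟙
  PS-isCommutativeRing = record
    { isRing = record
      { +-isAbelianGroup = record
        { isGroup = record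
          { isMonoid = record
            { isSemigroup = record
              { isMagma = record
                { isEquivalence = record
                  { refl  = mk≈ λ _ → refl
                  ; sym   = λ e → mk≈ λ n → sym (at e n)
                  ; trans = λ e d → mk≈ λ n → trans (at e n) (at d n)
                  }
                ; ∙-cong = λ e d → mk≈ λ n → cong₂ ℤ._+_ (at e n) (at d n)
                }
              ; assoc = λ f g h → mk≈ λ n → ℤₚ.+-assoc (f n) (g n) (h n)
              }
            ; identity = (λ f → mk≈ λ n → ℤₚ.+-identityˡ (f n)) , (λ f → mk≈ λ n → ℤₚ.+-identityʳ (f n))
            }
          ; inverse = (λ f → mk≈ λ n → ℤₚ.+-inverseˡ (f n)) , (λ f → mk≈ λ n → ℤₚ.+-inverseʳ (f n))
          ; ⁻¹-cong = λ e → mk≈ λ n → cong ℤ.-_ (at e n)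
          }
        ; comm = λ f g → mk≈ λ n → ℤₚ.+-comm (f n) (g n)
        }
      ; *-cong = λ e d → mk≈ λ n → *ₚ-cong-at n (λ a _ → at e a) (λ a _ → at d a)
      ; *-assoc = λ f g h → mk≈ λ n → *ₚ-assoc-at n f g h
      ; *-identity = identityˡ , (λ f → mk≈ λ n → trans (*ₚ-comm-at n f 𝟙) (at (identityˡ f) n))
      ; distrib = (λ f g h → mk≈ λ n → trans (*ₚ-comm-at n f (g ⊕ h))
                    (trans (*ₚ-distribʳ-at n f g h) (cong₂ ℤ._+_ (*ₚ-comm-at n g f) (*ₚ-comm-at n h f))))
                , (λ f g h → mk≈ λ n → *ₚ-distribʳ-at n f g h)
      }
    ; *-comm = λ f g → mk≈ λ n → *ₚ-comm-at n f g
    }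
    where
    identityˡ : ∀ f → 𝟙 ⊛ f ≈ f
    identityˡ f = mk≈ λ n → trans (const-*ₚ-at n (+ 1) f) (ℤₚ.*-identityˡ (f n))

PS-commutativeRing : CommutativeRing 0ℓ 0ℓ
PS-commutativeRing = record { isCommutativeRing = PS-isCommutativeRing }

module R = CommutativeRing PS-commutativeRing

opaque
  unfolding _⊕_ _⊛_ ⊖_

  const-+ : ∀ a b → const (a ℤ.+ b) ≈ const a ⊕ const b
  const-+ a b = mk≈ λ { zero → refl ; (suc n) → refl }

  const-* : ∀ a b → const (a ℤ.* b) ≈ const a ⊛ const b
  const-* a b = mk≈ λ { zero → refl ; (suc n) → sym (trans (const-*ₚ-at (suc n) a (const b)) (ℤₚ.*-zeroʳ a)) }

  const-neg : ∀ a → const (ℤ.- a) ≈ ⊖ const a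
  const-neg a = mk≈ λ { zero → refl ; (suc n) → refl }

const-hom : CommutativeRing.rawRing ℤₚ.+-*-commutativeRing -Raw-AlmostCommutative⟶ fromCommutativeRing PS-commutativeRing
const-hom = record
  { ⟦_⟧    = const
  ; +-homo = const-+
  ; *-homo = const-*
  ; -‿homo = const-neg
  ; 0-homo = mk≈ λ { zero → refl ; (suc n) → refl }
  ; 1-homo = R.refl
  }

const≟ : ∀ a b → Maybe (const a ≈ const b)
const≟ a b = Maybe.map (λ { refl → R.refl }) (dec⇒maybe (a ℤₚ.≟ b))

open RingSolver (CommutativeRing.rawRing ℤₚ.+-*-commutativeRing) (fromCommutativeRing PS-commutativeRing) const-hom const≟
  using (Polynomial; solve; _:=_; _:+_; _:*_; _:-_; :-_; con)

-- Congruences modulo q^N, products and sums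

infix 4 _≈[_]_

record _≈[_]_ (f : PS) (N : ℕ) (g : PS) : Set where
  constructor mk≈[]
  field at< : ∀ n → n < N → f n ≡ g n
open _≈[_]_ public

≈[]-setoid : ℕ → Setoid 0ℓ 0ℓ
≈[]-setoid N = record
  { Carrier = PS ; _≈_ = λ f g → f ≈[ N ] g
  ; isEquivalence = record
    { refl  = mk≈[] λ _ _ → refl
    ; sym   = λ e → mk≈[] λ n l → sym (at< e n l)
    ; trans = λ e d → mk≈[] λ n l → trans (at< e n l) (at< d n l)
    }
  }

module _ {N : ℕ} where
  open Setoid (≈[]-setoid N) public using () renaming (refl to refl[]; sym to sym[]; trans to trans[])

module ≈-Reasoning = SetoidReasoning R.setoid
module ≈[]-Reasoning N = SetoidReasoning (≈[]-setoid N)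

≈⇒≈[] : ∀ {N f g} → f ≈ g → f ≈[ N ] g
≈⇒≈[] e = mk≈[] λ n _ → at e n

≈[]⇒≈ : ∀ {f g} → (∀ N → f ≈[ N ] g) → f ≈ g
≈[]⇒≈ e = mk≈ λ n → at< (e (suc n)) n ℕₚ.≤-refl

≈[]-weaken : ∀ {M N f g} → M ≤ N → f ≈[ N ] g → f ≈[ M ] g
≈[]-weaken M≤N e = mk≈[] λ n l → at< e n (ℕₚ.<-≤-trans l M≤N)

opaque
  unfolding _⊕_ _⊛_ ⊖_

  ⊕-cong[] : ∀ {N f f′ g g′} → f ≈[ N ] f′ → g ≈[ N ] g′ → f ⊕ g ≈[ N ] f′ ⊕ g′
  ⊕-cong[] e d = mk≈[] λ n l → cong₂ ℤ._+_ (at< e n l) (at< d n l)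

  ⊖-cong[] : ∀ {N f g} → f ≈[ N ] g → ⊖ f ≈[ N ] ⊖ g
  ⊖-cong[] e = mk≈[] λ n l → cong ℤ.-_ (at< e n l)

  ⊛-cong[] : ∀ {N f f′ g g′} → f ≈[ N ] f′ → g ≈[ N ] g′ → f ⊛ g ≈[ N ] f′ ⊛ g′
  ⊛-cong[] e d = mk≈[] λ n l → *ₚ-cong-at n
    (λ a a≤n → at< e a (ℕₚ.≤-<-trans a≤n l)) (λ a a≤n → at< d a (ℕₚ.≤-<-trans a≤n l))

O[_] : ℕ → PS → Set
O[ N ] f = f ≈[ N ] zeroPS

O-⊛ˡ : ∀ {N f g} → O[ N ] f → O[ N ] (f ⊛ g)
O-⊛ˡ {g = g} e = trans[] (⊛-cong[] e refl[]) (≈⇒≈[] (R.zeroˡ g))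

O-⊛ʳ : ∀ {N} f {g} → O[ N ] g → O[ N ] (f ⊛ g)
O-⊛ʳ f e = trans[] (⊛-cong[] (refl[] {x = f}) e) (≈⇒≈[] (R.zeroʳ f))

O-⊕ : ∀ {N f g} → O[ N ] f → O[ N ] g → O[ N ] (f ⊕ g)
O-⊕ e d = trans[] (⊕-cong[] e d) (≈⇒≈[] (R.+-identityˡ zeroPS))

⊖-zero : ⊖ zeroPS ≈ zeroPS
⊖-zero = R.trans (R.sym (R.+-identityˡ _)) (R.-‿inverseʳ zeroPS)

O-⊖ : ∀ {N f} → O[ N ] f → O[ N ] (⊖ f)
O-⊖ e = trans[] (⊖-cong[] e) (≈⇒≈[] ⊖-zero)

O-⊝ : ∀ {N f g} → O[ N ] f → O[ N ] g → O[ N ] (f ⊝ g)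
O-⊝ e d = O-⊕ e (O-⊖ d)

-- If a + b < M + N, then a < M or b < N, so each summand of the coefficient has a zero factor.
O-⊛ : ∀ {M N f g} → O[ M ] f → O[ N ] g → O[ M + N ] (f ⊛ g)
O-⊛ {M} {N} {f} {g} e d = mk≈[] λ n l → trans (⊛-at f g n) (trans (sumTo-cong n (λ a a≤n → vanish n l a a≤n)) (sumTo-0 n))
  where
  vanish : ∀ n → n < M + N → ∀ a → a ≤ n → f a ℤ.* g (n ∸ a) ≡ + 0
  vanish n l a a≤n with a ℕₚ.<? M
  ... | yes a<M = trans (cong (ℤ._* g (n ∸ a)) (at< e a a<M)) (ℤₚ.*-zeroˡ (g (n ∸ a)))
  ... | no  a≮M = trans (cong (f a ℤ.*_) (at< d (n ∸ a) lt)) (ℤₚ.*-zeroʳ (f a))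
    where
    lt : n ∸ a < N
    lt = ℕₚ.+-cancelˡ-< a (n ∸ a) N (ℕₚ.≤-<-trans (ℕₚ.≤-reflexive (ℕₚ.m+[n∸m]≡n a≤n))
           (ℕₚ.<-≤-trans l (ℕₚ.+-monoˡ-≤ N (ℕₚ.≮⇒≥ a≮M))))

O⇒≈[] : ∀ {N f g} → O[ N ] (f ⊝ g) → f ≈[ N ] g
O⇒≈[] {N} {f} {g} e = begin
  f             ≈⟨ ≈⇒≈[] (solve 2 (λ f g → f := (f :- g) :+ g) R.refl f g) ⟩
  (f ⊝ g) ⊕ g   ≈⟨ ⊕-cong[] e refl[] ⟩
  zeroPS ⊕ g    ≈⟨ ≈⇒≈[] (R.+-identityˡ g) ⟩
  g             ∎
  where open ≈[]-Reasoning N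

≈[]⇒O : ∀ {N f g} → f ≈[ N ] g → O[ N ] (f ⊝ g)
≈[]⇒O {g = g} e = trans[] (⊕-cong[] e refl[]) (≈⇒≈[] (R.-‿inverseʳ g))

1-O : ∀ {N f} → O[ N ] f → 𝟙 ⊝ f ≈[ N ] 𝟙
1-O e = trans[] (⊕-cong[] refl[] (O-⊖ e)) (≈⇒≈[] (R.+-identityʳ 𝟙))

1+O : ∀ {N f} → O[ N ] f → 𝟙 ⊕ f ≈[ N ] 𝟙
1+O e = trans[] (⊕-cong[] refl[] e) (≈⇒≈[] (R.+-identityʳ 𝟙))

-- Monomials and geometric series

mono-0 : mono 0 ≈ 𝟙
mono-0 = mk≈ λ { zero → refl ; (suc n) → refl }

onePS≈𝟙 : onePS ≈ 𝟙
onePS≈𝟙 = mk≈ λ { zero → refl ; (suc n) → refl }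

opaque
  unfolding _⊛_

  mono-suc-⊛-0 : ∀ e f → (mono (suc e) ⊛ f) 0 ≡ + 0
  mono-suc-⊛-0 e f = ℤₚ.*-zeroˡ (f 0)

  mono-suc-⊛ : ∀ e f n → (mono (suc e) ⊛ f) (suc n) ≡ (mono e ⊛ f) n
  mono-suc-⊛ e f n = trans (*ₚ-suc (mono (suc e)) f n)
    (trans (cong (ℤ._+ (mono e ⊛ f) n) (ℤₚ.*-zeroˡ (f (suc n)))) (ℤₚ.+-identityˡ _))

mono-⊛-+ : ∀ e f n → (mono e ⊛ f) (e + n) ≡ f n
mono-⊛-+ zero    f n = at (R.trans (R.*-congʳ mono-0) (R.*-identityˡ f)) n
mono-⊛-+ (suc e) f n = trans (mono-suc-⊛ e f (e + n)) (mono-⊛-+ e f n)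

O-mono : ∀ e → O[ e ] (mono e)
O-mono zero    = mk≈[] λ n ()
O-mono (suc e) = mk≈[] λ { zero _ → refl ; (suc n) (s≤s l) → at< (O-mono e) n l }

O-mono-≤ : ∀ {N e} → N ≤ e → O[ N ] (mono e)
O-mono-≤ {e = e} N≤e = ≈[]-weaken N≤e (O-mono e)

mono-+ : ∀ a b → mono (a + b) ≈ mono a ⊛ mono b
mono-+ zero    b = R.sym (R.trans (R.*-congʳ mono-0) (R.*-identityˡ (mono b)))
mono-+ (suc a) b = mk≈ λ
  { zero    → sym (mono-suc-⊛-0 a (mono b))
  ; (suc n) → trans (at (mono-+ a b) n) (sym (mono-suc-⊛ a (mono b) n))
  }

mono-≡ : ∀ {a b} → a ≡ b → mono a ≈ mono b
mono-≡ refl = R.refl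

1-q^_ 1+q^_ : ℕ → PS
1-q^ m = 𝟙 ⊝ mono m
1+q^ m = 𝟙 ⊕ mono m

geom-0 : ∀ m → geom m 0 ≡ + 1
geom-0 m rewrite dec-true (m ∣? 0) (m ∣0) = refl

geom-< : ∀ m n → n < m → geom m n ≡ 𝟙 n
geom-< m zero    l = geom-0 m
geom-< m (suc n) l rewrite dec-false (m ∣? suc n) (λ d → ℕₚ.<⇒≱ l (∣⇒≤ d)) = refl

geom-+ : ∀ m n → geom m (m + n) ≡ geom m n
geom-+ m n with m ∣? n
... | yes d rewrite dec-true  (m ∣? (m + n)) (∣m∣n⇒∣m+n ∣-refl d) = refl
... | no  d rewrite dec-false (m ∣? (m + n)) (λ p → d (∣m+n∣m⇒∣n p ∣-refl)) = refl

geom-inverse : ∀ m → 1-q^ (suc m) ⊛ geom (suc m) ≈ 𝟙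
geom-inverse m = R.trans
  (solve 2 (λ x g → (con (+ 1) :- x) :* g := g :- x :* g) R.refl (mono (suc m)) (geom (suc m)))
  (mk≈ coeff)
  where
  coeff : ∀ n → (geom (suc m) ⊝ mono (suc m) ⊛ geom (suc m)) n ≡ 𝟙 n
  coeff n with n ℕₚ.<? suc m
  ... | yes l = trans (⊝-at _ _ n) (trans
    (cong₂ (λ a b → a ℤ.+ ℤ.- b) (geom-< (suc m) n l) (at< (O-⊛ˡ {g = geom (suc m)} (O-mono (suc m))) n l))
    (ℤₚ.+-identityʳ (𝟙 n)))
  ... | no ¬l with n′ , refl ← ℕₚ.m≤n⇒∃[o]m+o≡n (ℕₚ.≮⇒≥ ¬l) = trans (⊝-at _ _ n) (trans
    (cong₂ (λ a b → a ℤ.+ ℤ.- b) (geom-+ (suc m) n′) (mono-⊛-+ (suc m) (geom (suc m)) n′))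
    (ℤₚ.+-inverseʳ (geom (suc m) n′)))

-- Written as (1 - x) / (1 - x²) with x = q^{m+1}, which needs no inverse series other than `geom`.
1+q^-inv : ℕ → PS
1+q^-inv m = 1-q^ (suc m) ⊛ geom (suc m + suc m)

1+q^-inverse : ∀ m → 1+q^ (suc m) ⊛ 1+q^-inv m ≈ 𝟙
1+q^-inverse m = begin
  1+q^ (suc m) ⊛ (1-q^ (suc m) ⊛ g)         ≈⟨ solve 2 (λ x g → (con (+ 1) :+ x) :* ((con (+ 1) :- x) :* g) := (con (+ 1) :- x :* x) :* g) R.refl (mono (suc m)) g ⟩
  (𝟙 ⊝ mono (suc m) ⊛ mono (suc m)) ⊛ g     ≈⟨ R.*-congʳ (R.+-congˡ (R.-‿cong (mono-+ (suc m) (suc m)))) ⟨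
  1-q^ (suc m + suc m) ⊛ g                  ≈⟨ geom-inverse (m + suc m) ⟩
  𝟙                                         ∎
  where
  open ≈-Reasoning
  g = geom (suc m + suc m)

1+q^-geom : ∀ m → 1+q^ (suc m) ≈ 1-q^ (suc m + suc m) ⊛ geom (suc m)
1+q^-geom m = begin
  1+q^ (suc m)                                          ≈⟨ R.*-identityʳ _ ⟨
  1+q^ (suc m) ⊛ 𝟙                                      ≈⟨ R.*-congˡ (geom-inverse m) ⟨
  1+q^ (suc m) ⊛ (1-q^ (suc m) ⊛ geom (suc m))          ≈⟨ solve 2 (λ x g → (con (+ 1) :+ x) :* ((con (+ 1) :- x) :* g) := (con (+ 1) :- x :* x) :* g) R.refl (mono (suc m)) (geom (suc m)) ⟩
  (𝟙 ⊝ mono (suc m) ⊛ mono (suc m)) ⊛ geom (suc m)      ≈⟨ R.*-congʳ (R.+-congˡ (R.-‿cong (mono-+ (suc m) (suc m)))) ⟨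
  1-q^ (suc m + suc m) ⊛ geom (suc m)                   ∎
  where open ≈-Reasoning

-- Finite products, finite sums and infinite sums

∏ : ℕ → (ℕ → PS) → PS
∏ zero    f = 𝟙
∏ (suc n) f = ∏ n f ⊛ f n

∏-cong : ∀ n {f g} → (∀ s → f s ≈ g s) → ∏ n f ≈ ∏ n g
∏-cong zero    e = R.refl
∏-cong (suc n) e = R.*-cong (∏-cong n e) (e n)

∏-⊛ : ∀ n f g → ∏ n (λ s → f s ⊛ g s) ≈ ∏ n f ⊛ ∏ n g
∏-⊛ zero    f g = R.sym (R.*-identityˡ 𝟙)
∏-⊛ (suc n) f g = R.trans (R.*-congʳ (∏-⊛ n f g))
  (solve 4 (λ a b c d → a :* b :* (c :* d) := a :* c :* (b :* d)) R.refl (∏ n f) (∏ n g) (f n) (g n))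

∏-𝟙[] : ∀ {N} n {f} → (∀ s → f s ≈[ N ] 𝟙) → ∏ n f ≈[ N ] 𝟙
∏-𝟙[] zero    e = refl[]
∏-𝟙[] (suc n) e = trans[] (⊛-cong[] (∏-𝟙[] n e) (e n)) (≈⇒≈[] (R.*-identityˡ 𝟙))

∏-+ : ∀ m n f → ∏ (m + n) f ≈ ∏ m f ⊛ ∏ n (λ s → f (m + s))
∏-+ m zero    f rewrite ℕₚ.+-identityʳ m = R.sym (R.*-identityʳ _)
∏-+ m (suc n) f rewrite ℕₚ.+-suc m n = R.trans (R.*-congʳ (∏-+ m n f)) (R.*-assoc _ _ _)

Σ< : ℕ → (ℕ → PS) → PS
Σ< zero    f = zeroPS
Σ< (suc n) f = Σ< n f ⊕ f n

Σ<-cong[] : ∀ {N} n {f g} → (∀ s → s < n → f s ≈[ N ] g s) → Σ< n f ≈[ N ] Σ< n g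
Σ<-cong[] zero    e = refl[]
Σ<-cong[] (suc n) e = ⊕-cong[] (Σ<-cong[] n (λ s l → e s (ℕₚ.m<n⇒m<1+n l))) (e n ℕₚ.≤-refl)

Σ<-⊛ : ∀ n c f → c ⊛ Σ< n f ≈ Σ< n (λ s → c ⊛ f s)
Σ<-⊛ zero    c f = R.zeroʳ c
Σ<-⊛ (suc n) c f = R.trans (R.distribˡ c _ _) (R.+-congʳ (Σ<-⊛ n c f))

Σ<-⊕ : ∀ n f g → Σ< n (λ s → f s ⊕ g s) ≈ Σ< n f ⊕ Σ< n g
Σ<-⊕ zero    f g = R.sym (R.+-identityˡ zeroPS)
Σ<-⊕ (suc n) f g = R.trans (R.+-congʳ (Σ<-⊕ n f g))
  (solve 4 (λ a b c d → (a :+ b) :+ (c :+ d) := (a :+ c) :+ (b :+ d)) R.refl (Σ< n f) (Σ< n g) (f n) (g n))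

Σ<-telescope : ∀ n f g (α : ℕ → PS) → (∀ s → f s ≈ g s ⊕ (α s ⊝ α (suc s))) → Σ< n f ≈ Σ< n g ⊕ (α 0 ⊝ α n)
Σ<-telescope zero    f g α e = R.sym (R.trans (R.+-identityˡ _) (R.-‿inverseʳ (α 0)))
Σ<-telescope (suc n) f g α e = R.trans (R.+-cong (Σ<-telescope n f g α e) (e n))
  (solve 5 (λ s a b g c → (s :+ (a :- b)) :+ (g :+ (b :- c)) := (s :+ g) :+ (a :- c)) R.refl (Σ< n g) (α 0) (α n) (g n) (α (suc n)))

-- The sum of a sequence with f n = O(q^n), for which only the terms up to f t contribute to the coefficient of q^t.
Σ∞ : (ℕ → PS) → PS
Σ∞ f t = Σ< (suc t) f t

Σ<-tail : ∀ f → (∀ n → O[ n ] (f n)) → ∀ M d → Σ< (M + d) f ≈[ M ] Σ< M f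
Σ<-tail f small M zero    rewrite ℕₚ.+-identityʳ M = refl[]
Σ<-tail f small M (suc d) rewrite ℕₚ.+-suc M d = trans[]
  (⊕-cong[] (Σ<-tail f small M d) (≈[]-weaken (ℕₚ.m≤m+n M d) (small (M + d)))) (≈⇒≈[] (R.+-identityʳ _))

Σ∞≈Σ< : ∀ {f} → (∀ n → O[ n ] (f n)) → ∀ N → Σ∞ f ≈[ N ] Σ< N f
Σ∞≈Σ< {f} small N = mk≈[] coeff
  where
  coeff : ∀ n → n < N → Σ∞ f n ≡ Σ< N f n
  coeff n l with d , refl ← ℕₚ.m≤n⇒∃[o]m+o≡n l = sym (at< (Σ<-tail f small (suc n) d) n ℕₚ.≤-refl)

Σ∞-⊛ : ∀ c {f} → (∀ n → O[ n ] (f n)) → c ⊛ Σ∞ f ≈ Σ∞ (λ n → c ⊛ f n)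
Σ∞-⊛ c {f} small = ≈[]⇒≈ λ N → let open ≈[]-Reasoning N in begin
  c ⊛ Σ∞ f               ≈⟨ ⊛-cong[] (refl[] {x = c}) (Σ∞≈Σ< small N) ⟩
  c ⊛ Σ< N f             ≈⟨ ≈⇒≈[] (Σ<-⊛ N c f) ⟩
  Σ< N (λ n → c ⊛ f n)   ≈⟨ Σ∞≈Σ< (λ n → O-⊛ʳ c (small n)) N ⟨
  Σ∞ (λ n → c ⊛ f n)     ∎

Σ∞-⊕ : ∀ f g → Σ∞ (λ n → f n ⊕ g n) ≈ Σ∞ f ⊕ Σ∞ g
Σ∞-⊕ f g = mk≈ λ t → trans (at (Σ<-⊕ (suc t) f g) t) (trans (⊕-at _ _ t) (sym (⊕-at _ _ t)))

-- The lower boundary term is zero by hypothesis; the upper one, `α (suc t)`, is too small to reach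
-- the coefficient of q^t.
Σ∞-telescope : ∀ f g (α : ℕ → PS) → (∀ n → f n ≈ g n ⊕ (α n ⊝ α (suc n))) → α 0 ≈ zeroPS → (∀ n → O[ n ] (α n)) → Σ∞ f ≈ Σ∞ g
Σ∞-telescope f g α e α₀ small = mk≈ λ t → at< (sums t) t ℕₚ.≤-refl
  where
  sums : ∀ t → Σ< (suc t) f ≈[ suc t ] Σ< (suc t) g
  sums t = begin
    Σ< (suc t) f                              ≈⟨ ≈⇒≈[] (Σ<-telescope (suc t) f g α e) ⟩
    Σ< (suc t) g ⊕ (α 0 ⊝ α (suc t))          ≈⟨ ⊕-cong[] refl[] (O-⊝ (≈⇒≈[] α₀) (small (suc t))) ⟩
    Σ< (suc t) g ⊕ zeroPS                     ≈⟨ ≈⇒≈[] (R.+-identityʳ _) ⟩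
    Σ< (suc t) g                              ∎
    where open ≈[]-Reasoning (suc t)

private
  :1 : ∀ {n} → Polynomial n
  :1 = con (+ 1)

open Exp R.semiring using (_^_; ^-homo-*)

-- The Jacobi triple product

-- The triple product in the form of Ramanujan's theta function f(−α, −β), which needs no negative powers.
-- Write θ_n = (−1)^n P^{n(n−1)/2} α^n for all integers n; then ϑ α n = θ_n, ϑ β n = θ_{−n} and ψ n = θ_n + θ_{−n−1}.
module TripleProduct (α β : PS) where

  P : PS
  P = α ⊛ β

  P^-+ : ∀ a b {c} → a + b ≡ c → P ^ a ⊛ P ^ b ≈ P ^ c
  P^-+ a b refl = R.sym (^-homo-* P a b)

  P^-≡ : ∀ {a b} → a ≡ b → P ^ a ≈ P ^ b
  P^-≡ refl = R.refl

  1-P^_ : ℕ → PS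
  1-P^ n = 𝟙 ⊝ P ^ n

  ϑ : PS → ℕ → PS
  ϑ x zero    = 𝟙
  ϑ x (suc n) = ⊖ (P ^ n ⊛ x ⊛ ϑ x n)

  ψ : ℕ → PS
  ψ n = ϑ α n ⊕ ϑ β (suc n)

  -- ψ (n − 1), with ψ (−1) = ψ 0 by the symmetry n ↦ −n − 1.
  ψ⁻ : ℕ → PS
  ψ⁻ zero    = ψ 0
  ψ⁻ (suc n) = ψ n

  -- Multiplication by α or by β moves θ_n to a neighbour up to a power of P. The symmetry n ↦ -n -
  -- 1 exchanges the roles of α and βP, so the pairs ψ are closed under multiplication by α + βP.
  ψ-rec : ∀ n r → P ^ (n + r) ⊛ (α ⊕ β ⊛ P) ⊛ ψ n ≈ ⊖ (P ^ r ⊛ ψ (suc n) ⊕ P ^ (n + n + r + 1) ⊛ ψ⁻ n)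
  ψ-rec zero r = begin
    P ^ r ⊛ (α ⊕ β ⊛ P) ⊛ (𝟙 ⊕ ⊖ (𝟙 ⊛ β ⊛ 𝟙))
      ≈⟨ solve 3 (λ a b p → p :* (a :+ b :* (a :* b)) :* (:1 :+ :- (:1 :* b :* :1))
           := :- (p :* (:- (:1 :* a :* :1) :+ :- (a :* b :* :1 :* b :* :- (:1 :* b :* :1)))
                  :+ p :* (a :* b :* :1) :* (:1 :+ :- (:1 :* b :* :1)))) R.refl α β (P ^ r) ⟩
    ⊖ (P ^ r ⊛ ψ 1 ⊕ P ^ r ⊛ P ^ 1 ⊛ ψ 0)
      ≈⟨ R.-‿cong (R.+-congˡ (R.*-congʳ (P^-+ r 1 refl))) ⟩
    ⊖ (P ^ r ⊛ ψ 1 ⊕ P ^ (r + 1) ⊛ ψ 0) ∎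
    where open ≈-Reasoning
  ψ-rec (suc n) r = begin
    P ^ (suc n + r) ⊛ (α ⊕ β ⊛ P) ⊛ ψ (suc n)
      ≈⟨ R.*-congʳ (R.*-congʳ (P^-+ (suc n) r refl)) ⟨
    P ^ suc n ⊛ P ^ r ⊛ (α ⊕ β ⊛ P) ⊛ ψ (suc n)
      ≈⟨ solve 6 (λ a b p s x y → a :* b :* p :* s :* (a :+ b :* (a :* b)) :* (:- (p :* a :* x) :+ :- (a :* b :* p :* b :* y))
           := :- (s :* (:- (a :* b :* p :* a :* :- (p :* a :* x)) :+ :- (a :* b :* (a :* b :* p) :* b :* :- (a :* b :* p :* b :* y)))
                  :+ a :* b :* p :* (a :* b :* p) :* (s :* (a :* b)) :* (x :+ y)))
           R.refl α β (P ^ n) (P ^ r) (ϑ α n) (ϑ β (suc n)) ⟩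
    ⊖ (P ^ r ⊛ ψ (suc (suc n)) ⊕ P ^ suc n ⊛ P ^ suc n ⊛ (P ^ r ⊛ P) ⊛ ψ n)
      ≈⟨ R.-‿cong (R.+-congˡ (R.*-congʳ exponent)) ⟩
    ⊖ (P ^ r ⊛ ψ (suc (suc n)) ⊕ P ^ (suc n + suc n + r + 1) ⊛ ψ n) ∎
    where
    open ≈-Reasoning
    exponent : P ^ suc n ⊛ P ^ suc n ⊛ (P ^ r ⊛ P) ≈ P ^ (suc n + suc n + r + 1)
    exponent = begin
      P ^ suc n ⊛ P ^ suc n ⊛ (P ^ r ⊛ P)        ≈⟨ R.*-cong (P^-+ (suc n) (suc n) refl) (R.*-congˡ (R.sym (R.*-identityʳ P))) ⟩
      P ^ (suc n + suc n) ⊛ (P ^ r ⊛ P ^ 1)      ≈⟨ R.*-congˡ (P^-+ r 1 refl) ⟩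
      P ^ (suc n + suc n) ⊛ P ^ (r + 1)          ≈⟨ P^-+ (suc n + suc n) (r + 1) (sym (ℕₚ.+-assoc (suc n + suc n) r 1)) ⟩
      P ^ (suc n + suc n + r + 1)                ∎

  rise : ℕ → ℕ → PS
  rise a n = ∏ n (λ s → 1-P^ suc (a + s))

  rise-≡ : ∀ {a b} → a ≡ b → ∀ n → rise a n ≈ rise b n
  rise-≡ refl n = R.refl

  rise-sucˡ : ∀ a n → rise a (suc n) ≈ 1-P^ suc a ⊛ rise (suc a) n
  rise-sucˡ a zero    rewrite ℕₚ.+-identityʳ a = R.*-comm _ _
  rise-sucˡ a (suc n) rewrite ℕₚ.+-suc a n = R.trans (R.*-congʳ (rise-sucˡ a n)) (R.*-assoc _ _ _)

  -- K n r is (P;P)_M times the Gaussian binomial coefficient of M − n in 2M + 1, where M = n + r.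
  K : ℕ → ℕ → PS
  K n r = rise r n ⊛ rise (suc (n + n + r)) r

  K⁻ : ℕ → ℕ → PS
  K⁻ zero    r = K 0 r
  K⁻ (suc n) r = K n (suc r)

  K⁺ : ℕ → ℕ → PS
  K⁺ n zero    = zeroPS
  K⁺ n (suc r) = K (suc n) r

  1-cong : ∀ {x y} → x ≈ y → 𝟙 ⊝ x ≈ 𝟙 ⊝ y
  1-cong e = R.+-congˡ (R.-‿cong e)

  -- The q-Pascal rule applied twice, from top 2M + 1 to top 2M + 3; the prefactor 1 - P^{M+1} comes
  -- from (P;P)_{M+1}. The cases are separate because `K⁻` reflects at n = 0 and `K⁺` vanishes at r
  -- = 0. In each of them the rises common to all K are split off, and `combine` treats the
  -- remaining powers of P as variables.
  K-rec : ∀ n r → K n (suc r) ≈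
    1-P^ suc (n + r) ⊛ ((𝟙 ⊕ P ^ (n + r + (n + r) + 2)) ⊛ K n r ⊕ P ^ suc r ⊛ K⁻ n r ⊕ P ^ (n + n + r + 2) ⊛ K⁺ n r)
  K-rec zero zero = R.trans
    (solve 1 (λ p → :1 :* (:1 :* (:1 :- p :* (p :* (p :* :1))))
      := (:1 :- p :* :1) :* ((:1 :+ p :* (p :* :1)) :* (:1 :* :1) :+ p :* :1 :* (:1 :* :1))) R.refl P)
    (R.*-congˡ (R.sym (R.trans (R.+-congˡ (R.zeroʳ (P ^ 2))) (R.+-identityʳ _))))
  K-rec zero (suc r) = combine (P ^ suc (suc r)) (P ^ (suc r + 2)) (P ^ suc r) (rise (suc (suc (suc r))) r)
    (R.trans (R.*-identityˡ _) (R.trans (rise-sucˡ (suc (suc r)) r) (R.*-congʳ (1-cong (P^-≡ (e₁ r))))))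
    (R.*-congʳ (R.trans (R.*-identityˡ _) (1-cong (P^-≡ (cong suc (ℕₚ.+-identityʳ r))))))
    (R.sym (P^-+ (suc (suc r)) (suc (suc r)) (e₂ r)))
    (R.trans (P^-+ (suc r + 2) (suc r) (e₃ r)) (R.sym (P^-+ (suc (suc r)) (suc (suc r)) refl)))
    (R.trans (R.*-identityˡ _) (R.*-cong
      (R.*-congˡ (1-cong (R.sym (P^-+ (suc (suc r)) (suc (suc r)) (e₄ r)))))
      (1-cong (R.sym (P^-+ (suc (suc r)) (suc r + 2) (e₅ r))))))
    where
    e₁ : ∀ r → suc (suc (suc r)) ≡ suc r + 2
    e₁ = solve-∀
    e₂ : ∀ r → suc (suc r) + suc (suc r) ≡ suc r + suc r + 2
    e₂ = solve-∀
    e₃ : ∀ r → suc r + 2 + suc r ≡ suc (suc r) + suc (suc r)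
    e₃ = solve-∀
    e₄ : ∀ r → suc (suc r) + suc (suc r) ≡ suc (suc (suc (suc r)) + r)
    e₄ = solve-∀
    e₅ : ∀ r → suc (suc r) + (suc r + 2) ≡ suc (suc (suc (suc r)) + suc r)
    e₅ = solve-∀
    combine : ∀ t v x c {k k⁺ k′ w} → k ≈ (𝟙 ⊝ v) ⊛ c → k⁺ ≈ (𝟙 ⊝ x) ⊛ c → w ≈ t ⊛ t → v ⊛ x ≈ t ⊛ t →
      k′ ≈ c ⊛ (𝟙 ⊝ t ⊛ t) ⊛ (𝟙 ⊝ t ⊛ v) → k′ ≈ (𝟙 ⊝ t) ⊛ ((𝟙 ⊕ w) ⊛ k ⊕ t ⊛ k ⊕ v ⊛ k⁺)
    combine t v x c {k} {k⁺} {k′} {w} ek ek⁺ ew evx ek′ = begin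
      k′
        ≈⟨ ek′ ⟩
      c ⊛ (𝟙 ⊝ t ⊛ t) ⊛ (𝟙 ⊝ t ⊛ v)
        ≈⟨ solve 3 (λ c t v → c :* (:1 :- t :* t) :* (:1 :- t :* v)
             := (:1 :- t) :* ((:1 :+ t :* t) :* ((:1 :- v) :* c) :+ t :* ((:1 :- v) :* c) :+ (v :- t :* t) :* c)) R.refl c t v ⟩
      (𝟙 ⊝ t) ⊛ ((𝟙 ⊕ t ⊛ t) ⊛ ((𝟙 ⊝ v) ⊛ c) ⊕ t ⊛ ((𝟙 ⊝ v) ⊛ c) ⊕ (v ⊝ t ⊛ t) ⊛ c)
        ≈⟨ R.*-congˡ (R.+-cong (R.+-cong (R.*-cong (R.+-congˡ ew) ek) (R.*-congˡ ek)) (R.*-congʳ (R.+-congˡ (R.-‿cong evx)))) ⟨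
      (𝟙 ⊝ t) ⊛ ((𝟙 ⊕ w) ⊛ k ⊕ t ⊛ k ⊕ (v ⊝ v ⊛ x) ⊛ c)
        ≈⟨ R.*-congˡ (R.+-congˡ (solve 3 (λ v x c → (v :- v :* x) :* c := v :* ((:1 :- x) :* c)) R.refl v x c)) ⟩
      (𝟙 ⊝ t) ⊛ ((𝟙 ⊕ w) ⊛ k ⊕ t ⊛ k ⊕ v ⊛ ((𝟙 ⊝ x) ⊛ c))
        ≈⟨ R.*-congˡ (R.+-congˡ (R.*-congˡ ek⁺)) ⟨
      (𝟙 ⊝ t) ⊛ ((𝟙 ⊕ w) ⊛ k ⊕ t ⊛ k ⊕ v ⊛ k⁺) ∎
      where open ≈-Reasoning
  K-rec (suc n) zero = combine (P ^ 1) (P ^ suc (suc (suc (n + n)))) (rise 1 n)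
    (R.trans (R.*-identityʳ _) (rise-sucˡ 0 n))
    (R.*-congˡ (R.trans (R.*-identityˡ _) (1-cong (P^-≡ (e₁ n)))))
    (P^-+ 1 (suc (suc (suc (n + n)))) (e₂ n))
    (R.*-cong (R.*-congˡ (1-cong (P^-≡ (e₃ n)))) (R.trans (R.*-identityˡ _) (1-cong (R.sym (P^-+ 1 (suc n + 0 + (suc n + 0) + 2) (e₄ n))))))
    where
    e₁ : ∀ n → suc (suc (n + n + 1) + 0) ≡ suc (suc (suc (n + n)))
    e₁ = solve-∀
    e₂ : ∀ n → 1 + suc (suc (suc (n + n))) ≡ suc n + 0 + (suc n + 0) + 2
    e₂ = solve-∀
    e₃ : ∀ n → suc (1 + n) ≡ suc (suc n + 0)
    e₃ = solve-∀
    e₄ : ∀ n → 1 + (suc n + 0 + (suc n + 0) + 2) ≡ suc (suc (suc n + suc n + 1) + 0)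
    e₄ = solve-∀
    combine : ∀ p x c {k k⁻ k′ w d y} → k ≈ (𝟙 ⊝ p) ⊛ c → k⁻ ≈ c ⊛ (𝟙 ⊝ x) → p ⊛ x ≈ w →
      k′ ≈ c ⊛ d ⊛ (𝟙 ⊝ p ⊛ w) → k′ ≈ d ⊛ ((𝟙 ⊕ w) ⊛ k ⊕ p ⊛ k⁻ ⊕ y ⊛ zeroPS)
    combine p x c {k} {k⁻} {k′} {w} {d} {y} ek ek⁻ epx ek′ = begin
      k′
        ≈⟨ ek′ ⟩
      c ⊛ d ⊛ (𝟙 ⊝ p ⊛ w)
        ≈⟨ solve 4 (λ c d p w → c :* d :* (:1 :- p :* w) := d :* ((:1 :+ w) :* ((:1 :- p) :* c) :+ (p :- w) :* c)) R.refl c d p w ⟩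
      d ⊛ ((𝟙 ⊕ w) ⊛ ((𝟙 ⊝ p) ⊛ c) ⊕ (p ⊝ w) ⊛ c)
        ≈⟨ R.*-congˡ (R.+-cong (R.*-congˡ ek) (R.*-congʳ (R.+-congˡ (R.-‿cong epx)))) ⟨
      d ⊛ ((𝟙 ⊕ w) ⊛ k ⊕ (p ⊝ p ⊛ x) ⊛ c)
        ≈⟨ R.*-congˡ (R.+-congˡ (solve 3 (λ p x c → (p :- p :* x) :* c := p :* (c :* (:1 :- x))) R.refl p x c)) ⟩
      d ⊛ ((𝟙 ⊕ w) ⊛ k ⊕ p ⊛ (c ⊛ (𝟙 ⊝ x)))
        ≈⟨ R.*-congˡ (R.+-congˡ (R.*-congˡ ek⁻)) ⟨
      d ⊛ ((𝟙 ⊕ w) ⊛ k ⊕ p ⊛ k⁻)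
        ≈⟨ R.*-congˡ (R.trans (R.+-congˡ (R.zeroʳ y)) (R.+-identityʳ _)) ⟨
      d ⊛ ((𝟙 ⊕ w) ⊛ k ⊕ p ⊛ k⁻ ⊕ y ⊛ zeroPS) ∎
      where open ≈-Reasoning
  K-rec (suc n) (suc r) = combine (P ^ suc (suc r)) (P ^ (suc n + suc n + suc r + 2)) (P ^ x₁) (P ^ suc r)
    (P ^ (suc n + suc r + (suc n + suc r) + 2)) (rise (suc (suc r)) n) (rise b r)
    (R.*-cong (rise-sucˡ (suc r) n) (R.trans (rise-sucˡ (suc (suc n + suc n + suc r)) r) (R.*-congʳ (1-cong (P^-≡ (e₁ n r))))))
    (R.*-congˡ (R.trans (rise-sucˡ (suc (n + n + suc (suc r))) (suc r)) (R.*-cong (1-cong (P^-≡ (e₂ n r)))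
      (R.trans (rise-sucˡ (suc (suc (n + n + suc (suc r)))) r) (R.*-cong (1-cong (P^-≡ (e₃ n r))) (rise-≡ (e₄ n r) r))))))
    (R.*-cong (R.trans (rise-sucˡ r (suc n)) (R.*-congˡ (rise-sucˡ (suc r) n))) (rise-≡ (e₅ n r) r))
    (P^-+ (suc (suc r)) x₁ (e₆ n r))
    (P^-+ (suc n + suc n + suc r + 2) (suc r) (e₇ n r))
    (R.*-cong (R.*-congˡ (1-cong (P^-≡ (e₈ n r)))) (R.*-cong (R.*-cong (rise-≡ (e₉ n r) r) (1-cong (P^-≡ (e₁₀ n r))))
      (1-cong (R.sym (P^-+ (suc (suc r)) (suc n + suc n + suc r + 2) (e₁₁ n r))))))
    where
    x₁ = suc (suc (suc (suc (n + n + r))))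
    b = suc (suc (suc n + suc n + suc r))
    e₁ : ∀ n r → suc (suc (suc n + suc n + suc r)) ≡ suc n + suc n + suc r + 2
    e₁ = solve-∀
    e₂ : ∀ n r → suc (suc (n + n + suc (suc r))) ≡ suc (suc (suc (suc (n + n + r))))
    e₂ = solve-∀
    e₃ : ∀ n r → suc (suc (suc (n + n + suc (suc r)))) ≡ suc n + suc n + suc r + 2
    e₃ = solve-∀
    e₄ : ∀ n r → suc (suc (suc (n + n + suc (suc r)))) ≡ suc (suc (suc n + suc n + suc r))
    e₄ = solve-∀
    e₅ : ∀ n r → suc (suc (suc n) + suc (suc n) + r) ≡ suc (suc (suc n + suc n + suc r))
    e₅ = solve-∀
    e₆ : ∀ n r → suc (suc r) + suc (suc (suc (suc (n + n + r)))) ≡ suc n + suc r + (suc n + suc r) + 2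
    e₆ = solve-∀
    e₇ : ∀ n r → suc n + suc n + suc r + 2 + suc r ≡ suc n + suc r + (suc n + suc r) + 2
    e₇ = solve-∀
    e₈ : ∀ n r → suc (suc (suc r) + n) ≡ suc (suc n + suc r)
    e₈ = solve-∀
    e₉ : ∀ n r → suc (suc n + suc n + suc (suc r)) ≡ suc (suc (suc n + suc n + suc r))
    e₉ = solve-∀
    e₁₀ : ∀ n r → suc (suc (suc n + suc n + suc (suc r)) + r) ≡ suc n + suc r + (suc n + suc r) + 2
    e₁₀ = solve-∀
    e₁₁ : ∀ n r → suc (suc r) + (suc n + suc n + suc r + 2) ≡ suc (suc (suc n + suc n + suc (suc r)) + suc r)
    e₁₁ = solve-∀
    combine : ∀ u v x₁ x₂ w c₁ c₂ {k k⁻ k⁺ k′ d} →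
      k ≈ (𝟙 ⊝ u) ⊛ c₁ ⊛ ((𝟙 ⊝ v) ⊛ c₂) → k⁻ ≈ c₁ ⊛ ((𝟙 ⊝ x₁) ⊛ ((𝟙 ⊝ v) ⊛ c₂)) →
      k⁺ ≈ (𝟙 ⊝ x₂) ⊛ ((𝟙 ⊝ u) ⊛ c₁) ⊛ c₂ → u ⊛ x₁ ≈ w → v ⊛ x₂ ≈ w →
      k′ ≈ c₁ ⊛ d ⊛ (c₂ ⊛ (𝟙 ⊝ w) ⊛ (𝟙 ⊝ u ⊛ v)) → k′ ≈ d ⊛ ((𝟙 ⊕ w) ⊛ k ⊕ u ⊛ k⁻ ⊕ v ⊛ k⁺)
    combine u v x₁ x₂ w c₁ c₂ {k} {k⁻} {k⁺} {k′} {d} ek ek⁻ ek⁺ eux evx ek′ = begin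
      k′
        ≈⟨ ek′ ⟩
      c₁ ⊛ d ⊛ (c₂ ⊛ (𝟙 ⊝ w) ⊛ (𝟙 ⊝ u ⊛ v))
        -- The identity is (1 - w)(1 - uv) = (1 + w)(1 - u)(1 - v) + (u - w)(1 - v) + (v - w)(1 -
        -- u). The relations u x₁ = w = v x₂ then turn u - w and v - w into u(1 - x₁) and v(1 - x₂).
        ≈⟨ solve 6 (λ c₁ d c₂ w u v → c₁ :* d :* (c₂ :* (:1 :- w) :* (:1 :- u :* v)) :=
             d :* ((:1 :+ w) :* ((:1 :- u) :* c₁ :* ((:1 :- v) :* c₂)) :+ (u :- w) :* (c₁ :* ((:1 :- v) :* c₂))
                   :+ (v :- w) :* ((:1 :- u) :* c₁ :* c₂))) R.refl c₁ d c₂ w u v ⟩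
      d ⊛ ((𝟙 ⊕ w) ⊛ ((𝟙 ⊝ u) ⊛ c₁ ⊛ ((𝟙 ⊝ v) ⊛ c₂)) ⊕ (u ⊝ w) ⊛ (c₁ ⊛ ((𝟙 ⊝ v) ⊛ c₂)) ⊕ (v ⊝ w) ⊛ ((𝟙 ⊝ u) ⊛ c₁ ⊛ c₂))
        ≈⟨ R.*-congˡ (R.+-cong (R.+-cong (R.*-congˡ ek) (R.*-congʳ (R.+-congˡ (R.-‿cong eux)))) (R.*-congʳ (R.+-congˡ (R.-‿cong evx)))) ⟨
      d ⊛ ((𝟙 ⊕ w) ⊛ k ⊕ (u ⊝ u ⊛ x₁) ⊛ (c₁ ⊛ ((𝟙 ⊝ v) ⊛ c₂)) ⊕ (v ⊝ v ⊛ x₂) ⊛ ((𝟙 ⊝ u) ⊛ c₁ ⊛ c₂))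
        ≈⟨ R.*-congˡ (R.+-cong (R.+-congˡ
             (solve 4 (λ u x₁ c₁ y → (u :- u :* x₁) :* (c₁ :* y) := u :* (c₁ :* ((:1 :- x₁) :* y))) R.refl u x₁ c₁ ((𝟙 ⊝ v) ⊛ c₂)))
             (solve 4 (λ v x₂ y c₂ → (v :- v :* x₂) :* (y :* c₂) := v :* ((:1 :- x₂) :* y :* c₂)) R.refl v x₂ ((𝟙 ⊝ u) ⊛ c₁) c₂)) ⟩
      d ⊛ ((𝟙 ⊕ w) ⊛ k ⊕ u ⊛ (c₁ ⊛ ((𝟙 ⊝ x₁) ⊛ ((𝟙 ⊝ v) ⊛ c₂))) ⊕ v ⊛ ((𝟙 ⊝ x₂) ⊛ ((𝟙 ⊝ u) ⊛ c₁) ⊛ c₂))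
        ≈⟨ R.*-congˡ (R.+-cong (R.+-congˡ (R.*-congˡ ek⁻)) (R.*-congˡ ek⁺)) ⟨
      d ⊛ ((𝟙 ⊕ w) ⊛ k ⊕ u ⊛ k⁻ ⊕ v ⊛ k⁺) ∎
      where open ≈-Reasoning

  -- Σ_{m ≤ n} K m (n + r − m) ψ m
  S : ℕ → ℕ → PS
  S zero    r = K 0 r ⊛ ψ 0
  S (suc n) r = S n (suc r) ⊕ K (suc n) r ⊛ ψ (suc n)

  step : ℕ → PS
  step M = 1-P^ suc M ⊛ ((𝟙 ⊝ α ⊛ P ^ M) ⊛ (𝟙 ⊝ β ⊛ P ^ suc M))

  step-cong : ∀ {M N} → M ≡ N → step M ≈ step N
  step-cong refl = R.refl

  -- Multiplying the M-th finite theta sum by step M changes its n-th term by boundary n − boundary (n − 1)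
  -- apart from replacing K n (M − n) by K n (M + 1 − n); so the sums for consecutive M differ by the factor step M.
  boundary : ℕ → ℕ → PS
  boundary n r = 1-P^ suc (n + r) ⊛ (P ^ r ⊛ K n r ⊛ ψ (suc n) ⊝ P ^ (n + n + r + 2) ⊛ K⁺ n r ⊛ ψ n)

  boundary⁻ : ℕ → ℕ → PS
  boundary⁻ n r = 1-P^ suc (n + r) ⊛ (P ^ suc r ⊛ K⁻ n r ⊛ ψ n ⊝ P ^ (n + n + r + 1) ⊛ K n r ⊛ ψ⁻ n)

  boundary⁻-zero : ∀ r → boundary⁻ 0 r ≈ zeroPS
  boundary⁻-zero r = R.trans (R.*-congˡ (R.trans (R.+-congˡ (R.-‿cong (R.*-congʳ (R.*-congʳ (P^-≡ (ℕₚ.+-comm r 1))))))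
    (R.-‿inverseʳ _))) (R.zeroʳ _)

  boundary⁻-suc : ∀ n r → boundary⁻ (suc n) r ≈ boundary n (suc r)
  boundary⁻-suc n r = R.*-cong (1-cong (P^-≡ (cong suc (sym (ℕₚ.+-suc n r)))))
    (R.+-congˡ (R.-‿cong (R.*-congʳ (R.*-congʳ (P^-≡ (e n r))))))
    where
    e : ∀ n r → suc n + suc n + r + 1 ≡ n + n + suc r + 2
    e = solve-∀

  step-term : ∀ n r → step (n + r) ⊛ (K n r ⊛ ψ n) ≈ K n (suc r) ⊛ ψ n ⊕ (boundary n r ⊝ boundary⁻ n r)
  step-term n r = begin
    d ⊛ ((𝟙 ⊝ α ⊛ m) ⊛ (𝟙 ⊝ β ⊛ (P ⊛ m))) ⊛ (K n r ⊛ ψ n)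
      ≈⟨ solve 6 (λ a b d m k x → d :* ((:1 :- a :* m) :* (:1 :- b :* (a :* b :* m))) :* (k :* x)
           := d :* k :* ((:1 :+ a :* b :* m :* (a :* b :* m)) :* x :- m :* (a :+ b :* (a :* b)) :* x))
           R.refl α β d m (K n r) (ψ n) ⟩
    d ⊛ K n r ⊛ ((𝟙 ⊕ P ⊛ m ⊛ (P ⊛ m)) ⊛ ψ n ⊝ m ⊛ (α ⊕ β ⊛ P) ⊛ ψ n)
      ≈⟨ R.*-congˡ (R.+-cong (R.*-congʳ (R.+-congˡ (P^-+ (suc (n + r)) (suc (n + r)) (e (n + r))))) (R.-‿cong (ψ-rec n r))) ⟩
    d ⊛ K n r ⊛ ((𝟙 ⊕ w) ⊛ ψ n ⊝ ⊖ (P ^ r ⊛ ψ (suc n) ⊕ z ⊛ ψ⁻ n))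
      ≈⟨ rearrange d (K n r) (𝟙 ⊕ w) (ψ n) (P ^ r) (ψ (suc n)) z (ψ⁻ n) (P ^ suc r) (K⁻ n r) v (K⁺ n r) ⟩
    d ⊛ ((𝟙 ⊕ w) ⊛ K n r ⊕ P ^ suc r ⊛ K⁻ n r ⊕ v ⊛ K⁺ n r) ⊛ ψ n ⊕ (boundary n r ⊝ boundary⁻ n r)
      ≈⟨ R.+-congʳ (R.*-congʳ (K-rec n r)) ⟨
    K n (suc r) ⊛ ψ n ⊕ (boundary n r ⊝ boundary⁻ n r) ∎
    where
    open ≈-Reasoning
    e : ∀ M → suc M + suc M ≡ M + M + 2
    e = solve-∀
    d = 1-P^ suc (n + r)
    m = P ^ (n + r)
    w = P ^ (n + r + (n + r) + 2)
    v = P ^ (n + n + r + 2)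
    z = P ^ (n + n + r + 1)
    rearrange : ∀ d k w x s x⁺ z x⁻ p k⁻ v k⁺ → d ⊛ k ⊛ (w ⊛ x ⊝ ⊖ (s ⊛ x⁺ ⊕ z ⊛ x⁻)) ≈
      d ⊛ (w ⊛ k ⊕ p ⊛ k⁻ ⊕ v ⊛ k⁺) ⊛ x ⊕ (d ⊛ (s ⊛ k ⊛ x⁺ ⊝ v ⊛ k⁺ ⊛ x) ⊝ d ⊛ (p ⊛ k⁻ ⊛ x ⊝ z ⊛ k ⊛ x⁻))
    rearrange = solve 12 (λ d k w x s x⁺ z x⁻ p k⁻ v k⁺ → d :* k :* (w :* x :- :- (s :* x⁺ :+ z :* x⁻)) :=
      d :* (w :* k :+ p :* k⁻ :+ v :* k⁺) :* x :+ (d :* (s :* k :* x⁺ :- v :* k⁺ :* x) :- d :* (p :* k⁻ :* x :- z :* k :* x⁻))) R.refl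

  step-S : ∀ n r → step (n + r) ⊛ S n r ≈ S n (suc r) ⊕ boundary n r
  step-S zero    r = R.trans (step-term 0 r) (R.+-congˡ (R.trans (R.+-congˡ (R.-‿cong (boundary⁻-zero r)))
    (R.trans (R.+-congˡ ⊖-zero) (R.+-identityʳ _))))
  step-S (suc n) r = begin
    step (suc n + r) ⊛ (S n (suc r) ⊕ K (suc n) r ⊛ ψ (suc n))
      ≈⟨ R.distribˡ _ _ _ ⟩
    step (suc n + r) ⊛ S n (suc r) ⊕ step (suc n + r) ⊛ (K (suc n) r ⊛ ψ (suc n))
      ≈⟨ R.+-cong (R.*-congʳ (step-cong (sym (ℕₚ.+-suc n r)))) (step-term (suc n) r) ⟩
    step (n + suc r) ⊛ S n (suc r) ⊕ (K (suc n) (suc r) ⊛ ψ (suc n) ⊕ (boundary (suc n) r ⊝ boundary⁻ (suc n) r))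
      ≈⟨ R.+-cong (step-S n (suc r)) (R.+-congˡ (R.+-congˡ (R.-‿cong (boundary⁻-suc n r)))) ⟩
    S n (suc (suc r)) ⊕ boundary n (suc r) ⊕ (K (suc n) (suc r) ⊛ ψ (suc n) ⊕ (boundary (suc n) r ⊝ boundary n (suc r)))
      ≈⟨ solve 4 (λ s b k c → s :+ b :+ (k :+ (c :- b)) := s :+ k :+ c) R.refl _ _ _ _ ⟩
    S (suc n) (suc r) ⊕ boundary (suc n) r ∎
    where
    open ≈-Reasoning

  step-S₀ : ∀ M → step M ⊛ S M 0 ≈ S (suc M) 0
  step-S₀ M = begin
    step M ⊛ S M 0                ≈⟨ R.*-congʳ (step-cong (sym (ℕₚ.+-identityʳ M))) ⟩
    step (M + 0) ⊛ S M 0          ≈⟨ step-S M 0 ⟩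
    S M 1 ⊕ boundary M 0          ≈⟨ R.+-congˡ boundary-K ⟩
    S (suc M) 0                   ∎
    where
    open ≈-Reasoning
    -- At r = 0 the part with `K⁺` vanishes, and the boundary that is left is the new last term of
    -- the sum for M + 1.
    boundary-K : boundary M 0 ≈ K (suc M) 0 ⊛ ψ (suc M)
    boundary-K = begin
      1-P^ suc (M + 0) ⊛ (𝟙 ⊛ (rise 0 M ⊛ 𝟙) ⊛ ψ (suc M) ⊝ P ^ (M + M + 0 + 2) ⊛ zeroPS ⊛ ψ M)
        ≈⟨ R.*-cong (1-cong (P^-≡ (cong suc (ℕₚ.+-identityʳ M)))) (R.+-congˡ (R.-‿cong (R.trans (R.*-congʳ (R.zeroʳ _)) (R.zeroˡ _)))) ⟩
      1-P^ suc M ⊛ (𝟙 ⊛ (rise 0 M ⊛ 𝟙) ⊛ ψ (suc M) ⊝ zeroPS)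
        ≈⟨ R.*-congˡ (R.+-congˡ (⊖-zero)) ⟩
      1-P^ suc M ⊛ (𝟙 ⊛ (rise 0 M ⊛ 𝟙) ⊛ ψ (suc M) ⊕ zeroPS)
        ≈⟨ R.*-congˡ (R.+-identityʳ _) ⟩
      1-P^ suc M ⊛ (𝟙 ⊛ (rise 0 M ⊛ 𝟙) ⊛ ψ (suc M))
        ≈⟨ solve 3 (λ d r x → d :* (:1 :* (r :* :1) :* x) := r :* d :* :1 :* x) R.refl _ _ _ ⟩
      K (suc M) 0 ⊛ ψ (suc M) ∎

  finite-triple-product : ∀ M → (𝟙 ⊝ β) ⊛ ∏ M step ≈ S M 0
  finite-triple-product zero    =
    solve 1 (λ b → (:1 :- b) :* :1 := :1 :* :1 :* (:1 :+ :- (:1 :* b :* :1))) R.refl β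
  finite-triple-product (suc M) = begin
    (𝟙 ⊝ β) ⊛ (∏ M step ⊛ step M)    ≈⟨ R.trans (R.sym (R.*-assoc _ _ _)) (R.*-comm _ _) ⟩
    step M ⊛ ((𝟙 ⊝ β) ⊛ ∏ M step)    ≈⟨ R.*-congˡ (finite-triple-product M) ⟩
    step M ⊛ S M 0                   ≈⟨ step-S₀ M ⟩
    S (suc M) 0                      ∎
    where open ≈-Reasoning

  factor : ℕ → PS
  factor s = 1-P^ suc s ⊛ ((𝟙 ⊝ α ⊛ P ^ s) ⊛ (𝟙 ⊝ β ⊛ P ^ s))

  -- The symmetric product stops at β P^{M-1}; one more factor in β brings it to the range of the
  -- shifted product together with 1 - β.
  factor-step : ∀ M → ∏ M factor ⊛ (𝟙 ⊝ β ⊛ P ^ M) ≈ (𝟙 ⊝ β) ⊛ ∏ M step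
  factor-step zero    = solve 1 (λ b → :1 :* (:1 :- b :* :1) := (:1 :- b) :* :1) R.refl β
  factor-step (suc M) = begin
    ∏ M factor ⊛ (d ⊛ ((𝟙 ⊝ α ⊛ P ^ M) ⊛ (𝟙 ⊝ β ⊛ P ^ M))) ⊛ (𝟙 ⊝ β ⊛ P ^ suc M)
      ≈⟨ solve 5 (λ f d a b c → f :* (d :* (a :* b)) :* c := f :* b :* (d :* (a :* c))) R.refl _ _ _ _ _ ⟩
    ∏ M factor ⊛ (𝟙 ⊝ β ⊛ P ^ M) ⊛ step M
      ≈⟨ R.*-congʳ (factor-step M) ⟩
    (𝟙 ⊝ β) ⊛ ∏ M step ⊛ step M
      ≈⟨ R.*-assoc _ _ _ ⟩
    (𝟙 ⊝ β) ⊛ ∏ (suc M) step ∎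
    where
    open ≈-Reasoning
    d = 1-P^ suc M

  module _ (α-small : O[ 1 ] α) (β-small : O[ 1 ] β) where

    O-P^ : ∀ n → O[ n ] (P ^ n)
    O-P^ zero    = mk≈[] λ _ ()
    O-P^ (suc n) = O-⊛ (O-⊛ˡ α-small) (O-P^ n)

    1-P^≈𝟙 : ∀ {N} n → N ≤ n → 1-P^ n ≈[ N ] 𝟙
    1-P^≈𝟙 n N≤n = 1-O (≈[]-weaken N≤n (O-P^ n))

    O-ϑ : ∀ x → O[ 1 ] x → ∀ n → O[ n ] (ϑ x n)
    O-ϑ x x-small zero    = mk≈[] λ _ ()
    O-ϑ x x-small (suc n) = O-⊖ (O-⊛ (O-⊛ʳ (P ^ n) x-small) (O-ϑ x x-small n))

    O-ψ : ∀ n → O[ n ] (ψ n)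
    O-ψ n = O-⊕ (O-ϑ α α-small n) (≈[]-weaken (ℕₚ.n≤1+n n) (O-ϑ β β-small (suc n)))

    K≈𝟙 : ∀ n r → K n r ≈[ suc r ] 𝟙
    K≈𝟙 n r = trans[] (⊛-cong[]
      (∏-𝟙[] n (λ s → 1-P^≈𝟙 (suc (r + s)) (s≤s (ℕₚ.m≤m+n r s))))
      (∏-𝟙[] r (λ s → 1-P^≈𝟙 (suc (suc (n + n + r) + s))
        (s≤s (ℕₚ.≤-trans (ℕₚ.m≤n+m r (n + n)) (ℕₚ.≤-trans (ℕₚ.n≤1+n _) (ℕₚ.m≤m+n _ s)))))))
      (≈⇒≈[] (R.*-identityˡ 𝟙))

    -- The error ψ n (K n r - 1) is O(q^n) times O(q^{r+1}). As n + r = M throughout the finite sum,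
    -- the precision is the same for all its terms.
    Kψ≈ψ : ∀ n r → K n r ⊛ ψ n ≈[ suc (n + r) ] ψ n
    Kψ≈ψ n r = O⇒≈[] (trans[] (≈⇒≈[] (solve 2 (λ k x → k :* x :- x := x :* (k :- :1)) R.refl (K n r) (ψ n)))
      (≈[]-weaken (ℕₚ.≤-reflexive (sym (ℕₚ.+-suc n r))) (O-⊛ (O-ψ n) (≈[]⇒O (K≈𝟙 n r)))))

    S≈Σψ : ∀ n r → S n r ≈[ suc (n + r) ] Σ< (suc n) ψ
    S≈Σψ zero    r = trans[] (Kψ≈ψ 0 r) (≈⇒≈[] (R.sym (R.+-identityˡ _)))
    S≈Σψ (suc n) r = ⊕-cong[] (≈[]-weaken (ℕₚ.≤-reflexive (cong suc (sym (ℕₚ.+-suc n r)))) (S≈Σψ n (suc r))) (Kψ≈ψ (suc n) r)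

    triple-product : ∀ M → ∏ M factor ≈[ M ] Σ∞ ψ
    triple-product M = begin
      ∏ M factor                              ≈⟨ ≈⇒≈[] (R.*-identityʳ _) ⟨
      ∏ M factor ⊛ 𝟙                          ≈⟨ ⊛-cong[] (refl[] {x = ∏ M factor}) last≈𝟙 ⟨
      ∏ M factor ⊛ (𝟙 ⊝ β ⊛ P ^ M)            ≈⟨ ≈⇒≈[] (R.trans (factor-step M) (finite-triple-product M)) ⟩
      S M 0                                   ≈⟨ ≈[]-weaken (ℕₚ.≤-trans (ℕₚ.n≤1+n M) (ℕₚ.≤-reflexive (cong suc (sym (ℕₚ.+-identityʳ M))))) (S≈Σψ M 0) ⟩
      Σ< (suc M) ψ                            ≈⟨ ≈[]-weaken (ℕₚ.n≤1+n M) (Σ∞≈Σ< O-ψ (suc M)) ⟨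
      Σ∞ ψ                                    ∎
      where
      open ≈[]-Reasoning M
      last≈𝟙 : 𝟙 ⊝ β ⊛ P ^ M ≈[ M ] 𝟙
      last≈𝟙 = 1-O (O-⊛ʳ β (O-P^ M))

-- The product side

∏-𝟙 : ∀ n {f} → (∀ s → s < n → f s ≈ 𝟙) → ∏ n f ≈ 𝟙
∏-𝟙 zero    e = R.refl
∏-𝟙 (suc n) e = R.trans (R.*-cong (∏-𝟙 n (λ s l → e s (ℕₚ.m<n⇒m<1+n l))) (e n ℕₚ.≤-refl)) (R.*-identityˡ 𝟙)

∏-single : ∀ n f {a} → a < n → (∀ s → s < n → s ≢ a → f s ≈ 𝟙) → ∏ n f ≈ f a
∏-single (suc n) f {a} a<1+n e with a ℕₚ.≟ n
... | yes refl = R.trans (R.*-congʳ (∏-𝟙 n (λ s l → e s (ℕₚ.m<n⇒m<1+n l) (ℕₚ.<⇒≢ l)))) (R.*-identityˡ (f n))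
... | no  a≢n  = R.trans (R.*-cong
  (∏-single n f (ℕₚ.≤∧≢⇒< (ℕₚ.≤-pred a<1+n) a≢n) (λ s l → e s (ℕₚ.m<n⇒m<1+n l)))
  (e n ℕₚ.≤-refl (λ n≡a → a≢n (sym n≡a)))) (R.*-identityʳ (f a))

∏-tail : ∀ {N} M d f → (∀ s → f (M + s) ≈[ N ] 𝟙) → ∏ (M + d) f ≈[ N ] ∏ M f
∏-tail M d f e = trans[] (≈⇒≈[] (∏-+ M d f)) (trans[] (⊛-cong[] (refl[] {x = ∏ M f}) (∏-𝟙[] d e)) (≈⇒≈[] (R.*-identityʳ _)))

∏-tail-≤ : ∀ {N M M′} f → M ≤ M′ → (∀ s → f (M + s) ≈[ N ] 𝟙) → ∏ M′ f ≈[ N ] ∏ M f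
∏-tail-≤ {M = M} f M≤M′ e with d , refl ← ℕₚ.m≤n⇒∃[o]m+o≡n M≤M′ = ∏-tail M d f e

∏-double : ∀ M f → ∏ (M + M) f ≈ ∏ M (λ s → f (s + s)) ⊛ ∏ M (λ s → f (suc (s + s)))
∏-double zero    f = R.sym (R.*-identityˡ 𝟙)
∏-double (suc M) f rewrite ℕₚ.+-suc M M = R.trans (R.*-congʳ (R.*-congʳ (∏-double M f)))
  (solve 4 (λ a b c d → a :* b :* c :* d := a :* c :* (b :* d)) R.refl _ _ _ _)

-- The product of a sequence with f n = 1 + O(q^{n+1}), for which only the factors before f t contribute to the coefficient of q^t.
∏∞ : (ℕ → PS) → PS
∏∞ f t = ∏ t f t

∏∞≈∏ : ∀ {f} → (∀ n → f n ≈[ suc n ] 𝟙) → ∀ {N M} → N ≤ M → ∏∞ f ≈[ N ] ∏ M f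
∏∞≈∏ {f} e {N} {M} N≤M = mk≈[] λ n n<N → sym (at<
  (∏-tail-≤ f (ℕₚ.≤-trans (ℕₚ.<⇒≤ n<N) N≤M) (λ s → ≈[]-weaken (s≤s (ℕₚ.m≤m+n n s)) (e (n + s)))) n ℕₚ.≤-refl)

-- Both sides are reduced modulo p, so that ρ = p stands for the class of 0. This fits products over
-- 1, ..., Mp, which are cut into blocks with representatives 1, ..., p.
select : ℕ → ℕ → (ℕ → PS) → ℕ → PS
select p ρ f m = if modN m p ≡ᵇ modN ρ p then f m else 𝟙

if-true : ∀ {a b} {x y : PS} → a ≡ b → (if a ≡ᵇ b then x else y) ≈ x
if-true {a} refl rewrite dec-true (a ℕₚ.≟ a) refl = R.refl

if-false : ∀ {a b} {x y : PS} → a ≢ b → (if a ≡ᵇ b then x else y) ≈ y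
if-false {a} {b} ne rewrite dec-false (a ℕₚ.≟ b) ne = R.refl

suc-%-injective : ∀ p {a b} → a < suc p → b < suc p → suc a % suc p ≡ suc b % suc p → a ≡ b
suc-%-injective p {a} {b} a<p b<p e with suc a ℕₚ.≟ suc p | suc b ℕₚ.≟ suc p
... | yes refl | yes refl = refl
... | yes refl | no  b≢ with () ← trans (sym (n%n≡0 (suc p))) (trans e (m<n⇒m%n≡m (ℕₚ.≤∧≢⇒< b<p b≢)))
... | no  a≢ | yes refl with () ← trans (sym (n%n≡0 (suc p))) (trans (sym e) (m<n⇒m%n≡m (ℕₚ.≤∧≢⇒< a<p a≢)))
... | no  a≢ | no  b≢ = ℕₚ.suc-injective (trans (sym (m<n⇒m%n≡m (ℕₚ.≤∧≢⇒< a<p a≢))) (trans e (m<n⇒m%n≡m (ℕₚ.≤∧≢⇒< b<p b≢))))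

∏-select : ∀ p ρ f M → ρ < suc p → ∏ (M * suc p) (select (suc p) (suc ρ) f ∘ suc) ≈ ∏ M (λ s → f (s * suc p + suc ρ))
∏-select p ρ f zero    ρ<p = R.refl
∏-select p ρ f (suc M) ρ<p = begin
  ∏ (suc p + M * suc p) g
    ≡⟨ cong (λ n → ∏ n g) (ℕₚ.+-comm (suc p) (M * suc p)) ⟩
  ∏ (M * suc p + suc p) g
    ≈⟨ ∏-+ (M * suc p) (suc p) g ⟩
  ∏ (M * suc p) g ⊛ ∏ (suc p) (λ t → g (M * suc p + t))
    ≈⟨ R.*-cong (∏-select p ρ f M ρ<p) (∏-single (suc p) (λ t → g (M * suc p + t)) ρ<p others) ⟩
  ∏ M (λ s → f (s * suc p + suc ρ)) ⊛ g (M * suc p + ρ)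
    ≈⟨ R.*-congˡ (R.trans (if-true (residue ρ)) (R.reflexive (cong f (sym (ℕₚ.+-suc (M * suc p) ρ))))) ⟩
  ∏ (suc M) (λ s → f (s * suc p + suc ρ)) ∎
  where
  open ≈-Reasoning
  g = select (suc p) (suc ρ) f ∘ suc
  residue : ∀ t → suc (M * suc p + t) % suc p ≡ suc t % suc p
  residue t = trans (cong (_% suc p) (trans (sym (ℕₚ.+-suc (M * suc p) t)) (ℕₚ.+-comm (M * suc p) (suc t)))) ([m+kn]%n≡m%n (suc t) M (suc p))
  others : ∀ t → t < suc p → t ≢ ρ → g (M * suc p + t) ≈ 𝟙
  others t t<p t≢ρ = if-false (λ e → t≢ρ (suc-%-injective p t<p ρ<p (trans (sym (residue t)) e)))

geom≈𝟙 : ∀ m → geom m ≈[ m ] 𝟙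
geom≈𝟙 m = mk≈[] λ n l → geom-< m n l

if-≈[] : ∀ {N} b {x y z} → x ≈[ N ] z → y ≈[ N ] z → (if b then x else y) ≈[ N ] z
if-≈[] true  e d = e
if-≈[] false e d = d

-- The product F and the sequences y and c

geom≢2[4] : ℕ → PS
geom≢2[4] m = if not (m % 4 ≡ᵇ 2) then geom m else 𝟙

F : PS
F = ∏∞ (geom≢2[4] ∘ suc)

F≈∏ : ∀ {N M} → N ≤ M → F ≈[ N ] ∏ M (geom≢2[4] ∘ suc)
F≈∏ = ∏∞≈∏ (λ n → if-≈[] (not (suc n % 4 ≡ᵇ 2)) (geom≈𝟙 (suc n)) refl[])

geom≢2[4]-split : ∀ m → geom≢2[4] m ≈ select 4 1 geom m ⊛ select 4 3 geom m ⊛ select 4 4 geom m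
geom≢2[4]-split m = by-residue (m % 4) (m%n<n m 4)
  where
  by-residue : ∀ r → r < 4 → (if not (r ≡ᵇ 2) then geom m else 𝟙)
    ≈ (if r ≡ᵇ 1 then geom m else 𝟙) ⊛ (if r ≡ᵇ 3 then geom m else 𝟙) ⊛ (if r ≡ᵇ 0 then geom m else 𝟙)
  by-residue 0 _ = solve 1 (λ g → g := :1 :* :1 :* g) R.refl (geom m)
  by-residue 1 _ = solve 1 (λ g → g := g :* :1 :* :1) R.refl (geom m)
  by-residue 2 _ = solve 0 (:1 := :1 :* :1 :* :1) R.refl
  by-residue 3 _ = solve 1 (λ g → g := :1 :* g :* :1) R.refl (geom m)
  by-residue (suc (suc (suc (suc r)))) (s≤s (s≤s (s≤s (s≤s ()))))


-- A finite form of F = (-q;q²)_∞ / (q²;q²)_∞. The multiples of 4 cancel, and 1 + q^m = (1 - q^{2m})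
-- / (1 - q^m) handles the odd m. There are 2M odd m but only M factors 1 - q^{4s+2}; the missing
-- ones are 1 modulo q^{4M}.
F-odd-even : ∀ M → F ⊛ ∏ (M + M) (1-q^_ ∘ even) ≈[ M * 4 ] ∏ (M + M) (1+q^_ ∘ odd)
F-odd-even M = begin
  F ⊛ ∏ (M + M) (1-q^_ ∘ even)
    ≈⟨ ⊛-cong[] (trans[] (F≈∏ ℕₚ.≤-refl) (≈⇒≈[] F-split)) (≈⇒≈[] (R.trans (∏-double M (1-q^_ ∘ even)) (R.*-congˡ (∏-cong M (λ s → 1-q^-≡ (e₄ s)))))) ⟩
  G₁ ⊛ G₃ ⊛ G₄ ⊛ (H₂ ⊛ H₄)
    ≈⟨ ≈⇒≈[] (R.trans (solve 5 (λ a b c d c′ → a :* b :* c :* (d :* c′) := a :* b :* d :* (c′ :* c)) R.refl G₁ G₃ G₄ H₂ H₄)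
         (R.trans (R.*-congˡ G₄-inverse) (R.*-identityʳ _))) ⟩
  G₁ ⊛ G₃ ⊛ H₂
    ≈⟨ ⊛-cong[] (≈⇒≈[] (R.trans (R.*-cong (∏-cong M (λ s → geom-≡ (e₁ s))) (∏-cong M (λ s → geom-≡ (e₃ s)))) (R.sym (∏-double M (geom ∘ odd)))))
         (sym[] (∏-tail M M (1-q^_ ∘ even ∘ (λ s → s + s)) (λ s → 1-O (O-mono-≤ (bound s))))) ⟩
  ∏ (M + M) (geom ∘ odd) ⊛ ∏ (M + M) (1-q^_ ∘ (λ s → odd s + odd s))
    ≈⟨ ≈⇒≈[] (R.trans (R.*-comm _ _) (R.sym (R.trans (∏-cong (M + M) (λ s → 1+q^-geom (s + s))) (∏-⊛ (M + M) _ _)))) ⟩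
  ∏ (M + M) (1+q^_ ∘ odd) ∎
  where
  open ≈[]-Reasoning (M * 4)
  G₁ = ∏ M (λ s → geom (s * 4 + 1))
  G₃ = ∏ M (λ s → geom (s * 4 + 3))
  G₄ = ∏ M (λ s → geom (s * 4 + 4))
  H₂ = ∏ M (λ s → 1-q^ even (s + s))
  H₄ = ∏ M (λ s → 1-q^ (s * 4 + 4))
  1-q^-≡ : ∀ {a b} → a ≡ b → 1-q^ a ≈ 1-q^ b
  1-q^-≡ refl = R.refl
  geom-≡ : ∀ {a b} → a ≡ b → geom a ≈ geom b
  geom-≡ refl = R.refl
  e₁ : ∀ s → s * 4 + 1 ≡ suc (s + s + (s + s))
  e₁ = solve-∀
  e₃ : ∀ s → s * 4 + 3 ≡ suc (suc (s + s) + suc (s + s))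
  e₃ = solve-∀
  e₄ : ∀ s → suc (suc (s + s)) + suc (suc (s + s)) ≡ s * 4 + 4
  e₄ = solve-∀
  bound : ∀ s → M * 4 ≤ suc (M + s + (M + s)) + suc (M + s + (M + s))
  bound s = ℕₚ.≤-trans (ℕₚ.m≤m+n (M * 4) (2 + 4 * s)) (ℕₚ.≤-reflexive (e M s))
    where
    e : ∀ M s → M * 4 + (2 + 4 * s) ≡ suc (M + s + (M + s)) + suc (M + s + (M + s))
    e = solve-∀
  F-split : ∏ (M * 4) (geom≢2[4] ∘ suc) ≈ G₁ ⊛ G₃ ⊛ G₄
  F-split = R.trans (∏-cong (M * 4) (geom≢2[4]-split ∘ suc))
    (R.trans (∏-⊛ (M * 4) (λ s → select 4 1 geom (suc s) ⊛ select 4 3 geom (suc s)) (select 4 4 geom ∘ suc))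
    (R.*-cong (R.trans (∏-⊛ (M * 4) (select 4 1 geom ∘ suc) (select 4 3 geom ∘ suc))
      (R.*-cong (∏-select 3 0 geom M (s≤s z≤n)) (∏-select 3 2 geom M (s≤s (s≤s (s≤s z≤n))))))
      (∏-select 3 3 geom M (s≤s (s≤s (s≤s (s≤s z≤n)))))))
  G₄-inverse : H₄ ⊛ G₄ ≈ 𝟙
  G₄-inverse = R.trans (R.sym (∏-⊛ M _ _)) (∏-𝟙 M (λ s _ → subst (λ n → 1-q^ n ⊛ geom n ≈ 𝟙) (sym (ℕₚ.+-suc (s * 4) 3)) (geom-inverse (s * 4 + 3))))

-- y m = (−q^{2m+3};q²)_∞ / (q^{2m+2};q²)_∞, written through F = (−q;q²)_∞ / (q²;q²)_∞.
y : ℕ → PS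
y zero    = F ⊛ 1+q^-inv 0
y (suc m) = y m ⊛ 1-q^ even m ⊛ 1+q^-inv (suc m + suc m)

-- c n = (−q;q²)_n / (q²;q²)_n
c : ℕ → PS
c zero    = 𝟙
c (suc n) = c n ⊛ 1+q^ odd n ⊛ geom (even n)

y-rec : ∀ m → 1+q^ odd (suc m) ⊛ y (suc m) ≈ 1-q^ even m ⊛ y m
y-rec m = begin
  a ⊛ (y m ⊛ 1-q^ even m ⊛ b)    ≈⟨ solve 4 (λ a b y e → a :* (y :* e :* b) := a :* b :* (e :* y)) R.refl a b (y m) (1-q^ even m) ⟩
  a ⊛ b ⊛ (1-q^ even m ⊛ y m)    ≈⟨ R.trans (R.*-congʳ (1+q^-inverse (suc m + suc m))) (R.*-identityˡ _) ⟩
  1-q^ even m ⊛ y m              ∎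
  where
  open ≈-Reasoning
  a = 1+q^ odd (suc m)
  b = 1+q^-inv (suc m + suc m)

c-rec : ∀ n → 1-q^ even n ⊛ c (suc n) ≈ 1+q^ odd n ⊛ c n
c-rec n = begin
  a ⊛ (c n ⊛ 1+q^ odd n ⊛ b)    ≈⟨ solve 4 (λ a b y e → a :* (y :* e :* b) := a :* b :* (e :* y)) R.refl a b (c n) (1+q^ odd n) ⟩
  a ⊛ b ⊛ (1+q^ odd n ⊛ c n)    ≈⟨ R.trans (R.*-congʳ (geom-inverse (n + suc n))) (R.*-identityˡ _) ⟩
  1+q^ odd n ⊛ c n              ∎
  where
  open ≈-Reasoning
  a = 1-q^ even n
  b = geom (even n)

y-0 : 1+q^ odd 0 ⊛ y 0 ≈ F
y-0 = begin
  1+q^ 1 ⊛ (F ⊛ 1+q^-inv 0)    ≈⟨ solve 3 (λ a f b → a :* (f :* b) := a :* b :* f) R.refl _ _ _ ⟩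
  1+q^ 1 ⊛ 1+q^-inv 0 ⊛ F      ≈⟨ R.trans (R.*-congʳ (1+q^-inverse 0)) (R.*-identityˡ F) ⟩
  F                            ∎
  where open ≈-Reasoning

-- The recurrences of c and y cancel, so the product does not depend on n; at n = 0 it is F.
c-y : ∀ n → c n ⊛ (1+q^ odd n ⊛ y n) ≈ F
c-y zero    = R.trans (R.*-identityˡ _) y-0
c-y (suc n) = begin
  c (suc n) ⊛ (1+q^ odd (suc n) ⊛ y (suc n))    ≈⟨ R.*-congˡ (y-rec n) ⟩
  c (suc n) ⊛ (1-q^ even n ⊛ y n)               ≈⟨ solve 3 (λ c e y → c :* (e :* y) := e :* c :* y) R.refl _ _ _ ⟩
  1-q^ even n ⊛ c (suc n) ⊛ y n                 ≈⟨ R.*-congʳ (c-rec n) ⟩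
  1+q^ odd n ⊛ c n ⊛ y n                        ≈⟨ solve 3 (λ c e y → e :* c :* y := c :* (e :* y)) R.refl _ _ _ ⟩
  c n ⊛ (1+q^ odd n ⊛ y n)                      ≈⟨ c-y n ⟩
  F                                             ∎
  where open ≈-Reasoning

y-product : ∀ m → y m ⊛ ∏ (suc m) (1+q^_ ∘ odd) ≈ F ⊛ ∏ m (1-q^_ ∘ even)
y-product zero    = R.trans (solve 2 (λ y a → y :* (:1 :* a) := a :* y :* :1) R.refl (y 0) (1+q^ odd 0)) (R.*-congʳ y-0)
y-product (suc m) = begin
  y (suc m) ⊛ (P ⊛ 1+q^ odd (suc m))      ≈⟨ solve 3 (λ y p a → y :* (p :* a) := a :* y :* p) R.refl _ _ _ ⟩
  1+q^ odd (suc m) ⊛ y (suc m) ⊛ P        ≈⟨ R.*-congʳ (y-rec m) ⟩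
  1-q^ even m ⊛ y m ⊛ P                   ≈⟨ R.*-assoc _ _ _ ⟩
  1-q^ even m ⊛ (y m ⊛ P)                 ≈⟨ R.*-congˡ (y-product m) ⟩
  1-q^ even m ⊛ (F ⊛ Q)                   ≈⟨ solve 3 (λ e f q → e :* (f :* q) := f :* (q :* e)) R.refl _ _ _ ⟩
  F ⊛ (Q ⊛ 1-q^ even m)                   ∎
  where
  open ≈-Reasoning
  P = ∏ (suc m) (1+q^_ ∘ odd)
  Q = ∏ m (1-q^_ ∘ even)

-- By `y-product`, y m is F times a quotient of finite products. Lengthening these to 2(m + 1)
-- factors changes nothing at this precision, and then `F-odd-even` cancels F.
y≈𝟙 : ∀ m → y m ≈[ odd m ] 𝟙
y≈𝟙 m = begin
  y m
    ≈⟨ ≈⇒≈[] (R.trans (R.sym (R.*-identityʳ _)) (R.*-congˡ (R.sym inverse))) ⟩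
  y m ⊛ (O ⊛ O⁻¹)
    ≈⟨ ≈⇒≈[] (R.trans (R.sym (R.*-assoc _ _ _)) (R.*-congʳ (y-product m))) ⟩
  F ⊛ ∏ m (1-q^_ ∘ even) ⊛ O⁻¹
    ≈⟨ ⊛-cong[] (⊛-cong[] (refl[] {x = F}) (∏-tail-≤ (1-q^_ ∘ even) (ℕₚ.≤-trans (ℕₚ.n≤1+n m) (ℕₚ.m≤m+n (suc m) (suc m)))
         (λ s → 1-O (O-mono-≤ (ℕₚ.m≤n⇒m≤1+n (≤-even s)))))) refl[] ⟨
  F ⊛ ∏ (suc m + suc m) (1-q^_ ∘ even) ⊛ O⁻¹
    ≈⟨ ⊛-cong[] (≈[]-weaken bound (F-odd-even (suc m))) refl[] ⟩
  ∏ (suc m + suc m) (1+q^_ ∘ odd) ⊛ O⁻¹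
    ≈⟨ ⊛-cong[] (∏-tail-≤ (1+q^_ ∘ odd) (ℕₚ.m≤m+n (suc m) (suc m))
         (λ s → 1+O (O-mono-≤ (s≤s (ℕₚ.+-mono-≤ (ℕₚ.≤-trans (ℕₚ.n≤1+n m) (ℕₚ.m≤m+n (suc m) s)) (ℕₚ.≤-trans (ℕₚ.n≤1+n m) (ℕₚ.m≤m+n (suc m) s))))))) refl[] ⟩
  O ⊛ O⁻¹
    ≈⟨ ≈⇒≈[] inverse ⟩
  𝟙 ∎
  where
  open ≈[]-Reasoning (odd m)
  O = ∏ (suc m) (1+q^_ ∘ odd)
  O⁻¹ = ∏ (suc m) (λ s → 1+q^-inv (s + s))
  inverse : O ⊛ O⁻¹ ≈ 𝟙
  inverse = R.trans (R.sym (∏-⊛ (suc m) (1+q^_ ∘ odd) (λ s → 1+q^-inv (s + s)))) (∏-𝟙 (suc m) (λ s _ → 1+q^-inverse (s + s)))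
  ≤-even : ∀ s → odd m ≤ m + s + suc (m + s)
  ≤-even s = ℕₚ.≤-trans (s≤s (ℕₚ.+-mono-≤ (ℕₚ.m≤m+n m s) (ℕₚ.m≤m+n m s))) (ℕₚ.≤-reflexive (sym (ℕₚ.+-suc (m + s) (m + s))))
  bound : odd m ≤ suc m * 4
  bound = ℕₚ.≤-trans (ℕₚ.m≤m+n (odd m) (m + m + 3)) (ℕₚ.≤-reflexive (e m))
    where
    e : ∀ m → suc (m + m) + (m + m + 3) ≡ suc m * 4
    e = solve-∀

-- Residue classes modulo 4k and the base products

data AtMostOne : Bool → Bool → Bool → Bool → Set where
  none   : AtMostOne false false false false
  first  : AtMostOne true  false false false
  second : AtMostOne false true  false false
  third  : AtMostOne false false true  false
  fourth : AtMostOne false false false true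

≡ᵇ-refl : ∀ a → (a ≡ᵇ a) ≡ true
≡ᵇ-refl a = dec-true (a ℕₚ.≟ a) refl

≢⇒≡ᵇ : ∀ {a b} → a ≢ b → (a ≡ᵇ b) ≡ false
≢⇒≡ᵇ {a} {b} = dec-false (a ℕₚ.≟ b)

odd-%4 : ∀ a → odd a % 4 ≢ 2
odd-%4 a e = ℕₚ.even≢odd (1 + odd a / 4 * 2) a (trans (e′ (odd a / 4)) (trans (cong (_+ odd a / 4 * 4) (sym e))
  (trans (sym (m≡m%n+[m/n]*n (odd a) 4)) (e″ a))))
  where
  e′ : ∀ x → 2 * (1 + x * 2) ≡ 2 + x * 4
  e′ = solve-∀
  e″ : ∀ a → suc (a + a) ≡ suc (2 * a)
  e″ = solve-∀

odd-injective : ∀ {a b} → odd a ≡ odd b → a ≡ b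
odd-injective {a} {b} e = ℕₚ.*-cancelˡ-≡ a b 2 (trans (e′ a) (trans (ℕₚ.suc-injective e) (sym (e′ b))))
  where
  e′ : ∀ a → 2 * a ≡ a + a
  e′ = solve-∀

-- Disjointness of the excluded classes is what lets a product over allowed m be written as F times
-- three correcting products: no factor is removed twice. The two classes `odd a` and `odd b` avoid
-- 0 and 2 modulo 4 by parity.
exclusive : ∀ r {a b} → a ≢ b → AtMostOne (r % 4 ≡ᵇ 2) (r ≡ᵇ 0) (r ≡ᵇ odd a) (r ≡ᵇ odd b)
exclusive r {a} {b} a≢b with r ℕₚ.≟ 0 | r ℕₚ.≟ odd a | r ℕₚ.≟ odd b | r % 4 ℕₚ.≟ 2
... | yes refl | _ | _ | _ = second
... | no  _ | yes refl | _ | _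
  rewrite ≢⇒≡ᵇ (odd-%4 a) | ≡ᵇ-refl (a + a) | ≢⇒≡ᵇ {odd a} {odd b} (λ e → a≢b (odd-injective e)) = third
... | no  _ | no  _ | yes refl | _
  rewrite ≢⇒≡ᵇ (odd-%4 b) | ≡ᵇ-refl (b + b) | ≢⇒≡ᵇ {odd b} {odd a} (λ e → a≢b (odd-injective (sym e))) = fourth
... | no r≢0 | no r≢a | no r≢b | yes r≡2 rewrite ≢⇒≡ᵇ r≢0 | ≢⇒≡ᵇ r≢a | ≢⇒≡ᵇ r≢b | r≡2 = first
... | no r≢0 | no r≢a | no r≢b | no  r≢2 rewrite ≢⇒≡ᵇ r≢0 | ≢⇒≡ᵇ r≢a | ≢⇒≡ᵇ r≢b | ≢⇒≡ᵇ r≢2 = none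

exclude : ∀ {g e b₁ b₂ b₃ b₄} → e ⊛ g ≈ 𝟙 → AtMostOne b₁ b₂ b₃ b₄ →
  (if not b₁ ∧ not b₂ ∧ not b₃ ∧ not b₄ then g else 𝟙) ≈
  (if not b₁ then g else 𝟙) ⊛ (if b₂ then e else 𝟙) ⊛ (if b₃ then e else 𝟙) ⊛ (if b₄ then e else 𝟙)
exclude {g} {e} eg none   = solve 1 (λ g → g := g :* :1 :* :1 :* :1) R.refl g
exclude {g} {e} eg first  = solve 0 (:1 := :1 :* :1 :* :1 :* :1) R.refl
exclude {g} {e} eg second = R.trans (R.sym eg) (solve 2 (λ g e → e :* g := g :* e :* :1 :* :1) R.refl g e)
exclude {g} {e} eg third  = R.trans (R.sym eg) (solve 2 (λ g e → e :* g := g :* :1 :* e :* :1) R.refl g e)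
exclude {g} {e} eg fourth = R.trans (R.sym eg) (solve 2 (λ g e → e :* g := g :* :1 :* :1 :* e) R.refl g e)

module Base (l m : ℕ) where

  -- `odd a` and `odd b` are 2k + (2i - 1) and 2k - (2i - 1) for i = l + 1. Their sum is 4k, so the
  -- triple product with these exponents has P = q^{4k}.
  k modulus a b : ℕ
  k = suc (l + m)
  modulus = 4 * k
  a = suc (l + l + m)
  b = m

  geom-allowed : ℕ → PS
  geom-allowed n = if allowed k (suc l) n then geom n else 𝟙

  upper-residue : 2 * k + (2 * suc l ∸ 1) ≡ odd a
  upper-residue = e l m
    where
    e : ∀ l m → 2 * suc (l + m) + (l + suc (l + 0)) ≡ suc (suc (l + l + m) + suc (l + l + m))
    e = solve-∀

  lower-residue : 2 * k ∸ (2 * suc l ∸ 1) ≡ odd b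
  lower-residue = trans (cong (_∸ (l + suc (l + 0))) (e l m)) (ℕₚ.m+n∸n≡m (odd m) (l + suc (l + 0)))
    where
    e : ∀ l m → 2 * suc (l + m) ≡ suc (m + m) + (l + suc (l + 0))
    e = solve-∀

  odd-a<modulus : odd a < modulus
  odd-a<modulus = ℕₚ.≤-trans (ℕₚ.m≤m+n (suc (odd a)) (m + m)) (ℕₚ.≤-reflexive (e l m))
    where
    e : ∀ l m → suc (suc (suc (l + l + m) + suc (l + l + m))) + (m + m) ≡ 4 * suc (l + m)
    e = solve-∀

  odd-b<modulus : odd b < modulus
  odd-b<modulus = ℕₚ.≤-trans (ℕₚ.m≤m+n (suc (odd m)) (4 * l + 2 + 2 * m)) (ℕₚ.≤-reflexive (e l m))
    where
    e : ∀ l m → suc (suc (m + m)) + (4 * l + 2 + 2 * m) ≡ 4 * suc (l + m)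
    e = solve-∀

  a≢b : a ≢ b
  a≢b e = ℕₚ.<⇒≢ (s≤s (ℕₚ.m≤n+m m (l + l))) (sym e)

  modulus%modulus : modulus % modulus ≡ 0
  modulus%modulus = n%n≡0 modulus

  geom-allowed-split : ∀ s → geom-allowed (suc s) ≈
    geom≢2[4] (suc s) ⊛ select modulus modulus 1-q^_ (suc s) ⊛ select modulus (odd a) 1-q^_ (suc s) ⊛ select modulus (odd b) 1-q^_ (suc s)
  geom-allowed-split s
    rewrite upper-residue | lower-residue | m<n⇒m%n≡m odd-a<modulus | m<n⇒m%n≡m odd-b<modulus | modulus%modulus =
    -- Since 4 divides 4k, the class modulo 4 can be read off from the residue r modulo 4k.
    exclude (geom-inverse s) (subst (λ x → AtMostOne (x ≡ᵇ 2) (r ≡ᵇ 0) (r ≡ᵇ odd a) (r ≡ᵇ odd b))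
      (m∣n⇒o%n%m≡o%m 4 modulus (suc s) (m∣m*n k)) (exclusive r a≢b))
    where r = suc s % modulus

  partialProd≈∏ : ∀ N → partialProd k (suc l) N ≈ ∏ N (geom-allowed ∘ suc)
  partialProd≈∏ zero = onePS≈𝟙
  partialProd≈∏ (suc N) with allowed k (suc l) (suc N)
  ... | true  = R.trans (mk≈ λ n → sym (⊛-at (geom (suc N)) _ n)) (R.trans (R.*-comm _ _) (R.*-congʳ (partialProd≈∏ N)))
  ... | false = R.trans (partialProd≈∏ N) (R.sym (R.*-identityʳ _))

  Gbase≈∏ : ∀ {N M} → N ≤ M → Gbase k (suc l) ≈[ N ] ∏ M (geom-allowed ∘ suc)
  Gbase≈∏ N≤M = trans[] (≈⇒≈[] (mk≈ λ n → at (partialProd≈∏ n) n))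
    (∏∞≈∏ (λ n → if-≈[] (allowed k (suc l) (suc n)) (geom≈𝟙 (suc n)) refl[]) N≤M)

  open TripleProduct (mono (odd a)) (mono (odd b)) public

  P^≈mono : ∀ s → P ^ s ≈ mono (s * modulus)
  P^≈mono zero    = R.sym mono-0
  P^≈mono (suc s) = R.trans (R.*-cong (R.trans (R.sym (mono-+ (odd a) (odd b))) (mono-≡ (e l m))) (P^≈mono s)) (R.sym (mono-+ modulus (s * modulus)))
    where
    e : ∀ l m → suc (suc (l + l + m) + suc (l + l + m)) + suc (m + m) ≡ 4 * suc (l + m)
    e = solve-∀

  factor≈ : ∀ s → factor s ≈ 1-q^ (s * modulus + modulus) ⊛ 1-q^ (s * modulus + odd a) ⊛ 1-q^ (s * modulus + odd b)
  factor≈ s = R.trans (R.sym (R.*-assoc _ _ _)) (R.*-cong (R.*-cong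
      (1-cong (R.trans (P^≈mono (suc s)) (mono-≡ (ℕₚ.+-comm modulus (s * modulus)))))
      (1-cong (shift (odd a))))
      (1-cong (shift (odd b))))
    where
    shift : ∀ e → mono e ⊛ P ^ s ≈ mono (s * modulus + e)
    shift e = R.trans (R.*-congˡ (P^≈mono s)) (R.trans (R.*-comm _ _) (R.sym (mono-+ (s * modulus) e)))

  Gbase≈F⊛Σψ : Gbase k (suc l) ≈ F ⊛ Σ∞ ψ
  Gbase≈F⊛Σψ = ≈[]⇒≈ λ N → let open ≈[]-Reasoning N in begin
    Gbase k (suc l)
      ≈⟨ Gbase≈∏ (ℕₚ.m≤m*n N modulus) ⟩
    ∏ (N * modulus) (geom-allowed ∘ suc)
      ≈⟨ ≈⇒≈[] (split N) ⟩
    ∏ (N * modulus) (geom≢2[4] ∘ suc) ⊛ ∏ N factor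
      ≈⟨ ⊛-cong[] (sym[] (F≈∏ (ℕₚ.m≤m*n N modulus))) (triple-product (O-mono-≤ (s≤s z≤n)) (O-mono-≤ (s≤s z≤n)) N) ⟩
    F ⊛ Σ∞ ψ ∎
    where
    split : ∀ N → ∏ (N * modulus) (geom-allowed ∘ suc) ≈ ∏ (N * modulus) (geom≢2[4] ∘ suc) ⊛ ∏ N factor
    split N = begin
      ∏ n (geom-allowed ∘ suc)
        ≈⟨ ∏-cong n geom-allowed-split ⟩
      ∏ n (λ s → g s ⊛ x s ⊛ x₁ s ⊛ x₂ s)
        ≈⟨ R.trans (∏-⊛ n (λ s → g s ⊛ x s ⊛ x₁ s) x₂) (R.*-congʳ (R.trans (∏-⊛ n (λ s → g s ⊛ x s) x₁) (R.*-congʳ (∏-⊛ n g x)))) ⟩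
      ∏ n g ⊛ ∏ n x ⊛ ∏ n x₁ ⊛ ∏ n x₂
        -- `modulus` reduces to `suc (l + m + 3 * k)`, whose predecessor is the argument that
        -- `∏-select` expects.
        ≈⟨ R.*-cong (R.*-cong (R.*-congˡ (∏-select (l + m + 3 * k) (l + m + 3 * k) 1-q^_ N ℕₚ.≤-refl))
             (∏-select (l + m + 3 * k) (a + a) 1-q^_ N (ℕₚ.<⇒≤ odd-a<modulus)))
             (∏-select (l + m + 3 * k) (b + b) 1-q^_ N (ℕₚ.<⇒≤ odd-b<modulus)) ⟩
      ∏ n g ⊛ ∏ N z ⊛ ∏ N z₁ ⊛ ∏ N z₂
        ≈⟨ solve 4 (λ g z z₁ z₂ → g :* z :* z₁ :* z₂ := g :* (z :* z₁ :* z₂)) R.refl _ _ _ _ ⟩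
      ∏ n g ⊛ (∏ N z ⊛ ∏ N z₁ ⊛ ∏ N z₂)
        ≈⟨ R.*-congˡ (R.trans (∏-cong N factor≈) (R.trans (∏-⊛ N (λ s → z s ⊛ z₁ s) z₂) (R.*-congʳ (∏-⊛ N z z₁)))) ⟨
      ∏ n g ⊛ ∏ N factor ∎
      where
      open ≈-Reasoning
      n = N * modulus
      g = geom≢2[4] ∘ suc
      x = select modulus modulus 1-q^_ ∘ suc
      x₁ = select modulus (odd a) 1-q^_ ∘ suc
      x₂ = select modulus (odd b) 1-q^_ ∘ suc
      z z₁ z₂ : ℕ → PS
      z s = 1-q^ (s * modulus + modulus)
      z₁ s = 1-q^ (s * modulus + odd a)
      z₂ s = 1-q^ (s * modulus + odd b)

-- The series for G_l

mono-cong-+ : ∀ {x} a b → x ≡ a + b → mono x ≈ mono a ⊛ mono b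
mono-cong-+ a b refl = mono-+ a b

sgn : ℕ → PS
sgn zero    = 𝟙
sgn (suc n) = ⊖ sgn n

term : ℕ → ℕ → ℕ → ℕ → PS
term j l m n = sgn n ⊛ (c n ⊛ y (n + j)) ⊛ (mono (E j l m n) ⊛ 1+q^ odd (n + j) ⊝ mono (D j l m n) ⊛ 1+q^ odd n)

-- closed j l m is G_{(k−1)j+i}, where i = l + 1 and k = l + m + 1.
closed : ℕ → ℕ → ℕ → PS
closed j l m = Σ∞ (term j l m)

open Exponents

O-term : ∀ j l m n → O[ n ] (term j l m n)
O-term j l m n = O-⊛ʳ _ (O-⊝ (O-⊛ˡ (O-mono-≤ (n≤E j l m n))) (O-⊛ˡ (O-mono-≤ (n≤D j l m n))))

-- The factor of the telescoping sequences that removes their value at 0; at n + 1 it equals (1 +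
-- q^{2n+1}) c_n by `c-rec`.
vanishing : ℕ → PS
vanishing n = 1-q^ (n + n) ⊛ c n

vanishing-zero : vanishing 0 ≈ zeroPS
vanishing-zero = R.trans (R.*-congʳ (R.trans (R.+-congˡ (R.-‿cong mono-0)) (R.-‿inverseʳ 𝟙))) (R.zeroˡ (c 0))

y-rec′ : ∀ n j → 1+q^ odd (n + suc j) ⊛ y (n + suc j) ≈ 1-q^ even (n + j) ⊛ y (n + j)
y-rec′ n j rewrite ℕₚ.+-suc n j = y-rec (n + j)

-- The defining recursion for i = a + 2 and level j + 1, multiplied by q^{2(j+1)(i-1)} and solved
-- for G_{(k-1)j+k-i+1}, so that no negative powers occur.
closed-rec : ∀ j a m → closed j m (suc a) ≈
  closed j (suc m) a ⊕ (mono (suc (lead j a)) ⊛ closed (suc j) (suc a) m ⊕ mono (lead j a) ⊛ closed (suc j) a (suc m))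
closed-rec j a m = begin
  Σ∞ t₁
    ≈⟨ Σ∞-telescope t₁ (λ n → t₂ n ⊕ (mono e₃ ⊛ t₃ n ⊕ mono e₄ ⊛ t₄ n)) α termwise α-zero α-small ⟩
  Σ∞ (λ n → t₂ n ⊕ (mono e₃ ⊛ t₃ n ⊕ mono e₄ ⊛ t₄ n))
    ≈⟨ R.trans (Σ∞-⊕ t₂ _) (R.+-congˡ (Σ∞-⊕ (λ n → mono e₃ ⊛ t₃ n) (λ n → mono e₄ ⊛ t₄ n))) ⟩
  Σ∞ t₂ ⊕ (Σ∞ (λ n → mono e₃ ⊛ t₃ n) ⊕ Σ∞ (λ n → mono e₄ ⊛ t₄ n))
    ≈⟨ R.+-congˡ (R.+-cong (Σ∞-⊛ (mono e₃) (O-term (suc j) (suc a) m)) (Σ∞-⊛ (mono e₄) (O-term (suc j) a (suc m)))) ⟨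
  closed j (suc m) a ⊕ (mono e₃ ⊛ closed (suc j) (suc a) m ⊕ mono e₄ ⊛ closed (suc j) a (suc m)) ∎
  where
  open ≈-Reasoning
  e₃ = suc (lead j a)
  e₄ = lead j a
  t₁ = term j m (suc a)
  t₂ = term j (suc m) a
  t₃ = term (suc j) (suc a) m
  t₄ = term (suc j) a (suc m)
  α : ℕ → PS
  α n = sgn n ⊛ mono (E j m (suc a) n) ⊛ (1+q^ odd (n + j) ⊛ y (n + j)) ⊛ vanishing n
  α-zero : α 0 ≈ zeroPS
  α-zero = R.trans (R.*-congˡ vanishing-zero) (R.zeroʳ _)
  α-small : ∀ n → O[ n ] (α n)
  α-small n = O-⊛ˡ (O-⊛ˡ (O-⊛ʳ (sgn n) (O-mono-≤ (n≤E j m (suc a) n))))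
  termwise : ∀ n → t₁ n ≈ t₂ n ⊕ (mono e₃ ⊛ t₃ n ⊕ mono e₄ ⊛ t₄ n) ⊕ (α n ⊝ α (suc n))
  termwise n = begin
    s ⊛ (c n ⊛ Y) ⊛ (A ⊛ (𝟙 ⊕ w) ⊝ mono (D j m (suc a) n) ⊛ (𝟙 ⊕ o))
      ≈⟨ R.*-congˡ (R.+-congˡ (R.-‿cong (R.*-congʳ (mono-cong-+ _ _ (D-shift j a m n))))) ⟩
    s ⊛ (c n ⊛ Y) ⊛ (A ⊛ (𝟙 ⊕ w) ⊝ B ⊛ v ⊛ (𝟙 ⊕ o))
      -- The difference of the two terms of level j splits in two: the part with 1 - v passes to
      -- level j + 1 by the recurrence of y, and the part with 1 - u is `α n`.
      ≈⟨ solve 9 (λ s c Y A w B v o u → s :* (c :* Y) :* (A :* (:1 :+ w) :- B :* v :* (:1 :+ o)) :=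
           s :* (c :* Y) :* (A :* u :* (:1 :+ w) :- B :* (:1 :+ o)) :+ s :* c :* B :* (:1 :+ o) :* ((:1 :- v) :* Y)
           :+ s :* A :* ((:1 :+ w) :* Y) :* ((:1 :- u) :* c)) R.refl s (c n) Y A w B v o u ⟩
    s ⊛ (c n ⊛ Y) ⊛ (A ⊛ u ⊛ (𝟙 ⊕ w) ⊝ B ⊛ (𝟙 ⊕ o)) ⊕ s ⊛ c n ⊛ B ⊛ (𝟙 ⊕ o) ⊛ ((𝟙 ⊝ v) ⊛ Y) ⊕ α n
      ≈⟨ R.+-congʳ (R.+-cong (R.*-congˡ (R.+-congʳ (R.*-congʳ (mono-cong-+ _ _ (E-shift j a m n))))) (R.*-congˡ (y-rec′ n j))) ⟨
    t₂ n ⊕ s ⊛ c n ⊛ B ⊛ (𝟙 ⊕ o) ⊛ ((𝟙 ⊕ w′) ⊛ Y′) ⊕ α n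
      -- The transferred part is the sum of the leading halves of the two terms of level j + 1.
      -- Their subtracted halves, which contain Z, add up to `α (suc n)`.
      ≈⟨ solve 10 (λ t s c B o w Y Z v a → t :+ s :* c :* B :* (:1 :+ o) :* ((:1 :+ w) :* Y) :+ a :=
           t :+ (s :* (c :* Y) :* (B :* o :* (:1 :+ w) :- Z :* (:1 :+ o)) :+ s :* (c :* Y) :* (B :* (:1 :+ w) :- Z :* w :* (:1 :+ o)))
           :+ (a :- (:- s) :* Z :* ((:1 :+ w) :* Y) :* ((:1 :+ o) :* c))) R.refl (t₂ n) s (c n) B o w′ Y′ Z v (α n) ⟩
    t₂ n ⊕ (s ⊛ (c n ⊛ Y′) ⊛ (B ⊛ o ⊛ (𝟙 ⊕ w′) ⊝ Z ⊛ (𝟙 ⊕ o)) ⊕ s ⊛ (c n ⊛ Y′) ⊛ (B ⊛ (𝟙 ⊕ w′) ⊝ Z ⊛ w′ ⊛ (𝟙 ⊕ o)))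
      ⊕ (α n ⊝ (⊖ s) ⊛ Z ⊛ ((𝟙 ⊕ w′) ⊛ Y′) ⊛ ((𝟙 ⊕ o) ⊛ c n))
      ≈⟨ R.+-cong (R.+-congˡ (R.+-cong third-term fourth-term)) (R.+-congˡ (R.-‿cong next)) ⟨
    t₂ n ⊕ (mono e₃ ⊛ t₃ n ⊕ mono e₄ ⊛ t₄ n) ⊕ (α n ⊝ α (suc n)) ∎
    where
    s = sgn n
    Y = y (n + j)
    Y′ = y (n + suc j)
    A = mono (E j m (suc a) n)
    B = mono (D j (suc m) a n)
    Z = mono (E j m (suc a) (suc n))
    u = mono (n + n)
    v = mono (even (n + j))
    w = mono (odd (n + j))
    w′ = mono (odd (n + suc j))
    o = mono (odd n)
    third-term : mono e₃ ⊛ t₃ n ≈ s ⊛ (c n ⊛ Y′) ⊛ (B ⊛ o ⊛ (𝟙 ⊕ w′) ⊝ Z ⊛ (𝟙 ⊕ o))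
    third-term = R.trans
      (solve 6 (λ e f x z w o → e :* (f :* (x :* w :- z :* o)) := f :* (e :* x :* w :- e :* z :* o)) R.refl (mono e₃) (s ⊛ (c n ⊛ Y′)) _ _ (𝟙 ⊕ w′) (𝟙 ⊕ o))
      (R.*-congˡ (R.+-cong
        (R.*-congʳ (R.trans (R.sym (mono-+ e₃ (E (suc j) (suc a) m n))) (mono-cong-+ _ _ (lead-E₁ j a m n))))
        (R.-‿cong (R.*-congʳ (R.trans (R.sym (mono-+ e₃ (D (suc j) (suc a) m n))) (mono-≡ (lead-D₁ j a m n)))))))
    fourth-term : mono e₄ ⊛ t₄ n ≈ s ⊛ (c n ⊛ Y′) ⊛ (B ⊛ (𝟙 ⊕ w′) ⊝ Z ⊛ w′ ⊛ (𝟙 ⊕ o))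
    fourth-term = R.trans
      (solve 6 (λ e f x z w o → e :* (f :* (x :* w :- z :* o)) := f :* (e :* x :* w :- e :* z :* o)) R.refl (mono e₄) (s ⊛ (c n ⊛ Y′)) _ _ (𝟙 ⊕ w′) (𝟙 ⊕ o))
      (R.*-congˡ (R.+-cong
        (R.*-congʳ (R.trans (R.sym (mono-+ e₄ (E (suc j) a (suc m) n))) (mono-≡ (lead-E₂ j a m n))))
        (R.-‿cong (R.*-congʳ (R.trans (R.sym (mono-+ e₄ (D (suc j) a (suc m) n))) (mono-cong-+ _ _ (lead-D₂ j a m n)))))))
    next : α (suc n) ≈ (⊖ s) ⊛ Z ⊛ ((𝟙 ⊕ w′) ⊛ Y′) ⊛ ((𝟙 ⊕ o) ⊛ c n)
    next = R.*-cong (R.*-congˡ (R.reflexive (cong (λ x → 1+q^ odd x ⊛ y x) (sym (ℕₚ.+-suc n j))))) (c-rec n)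

-- The consistency of the formula at the index shared by two consecutive blocks: i = k at level j is
-- i = 1 at level j + 1.
closed-first : ∀ j l → closed j l 0 ≈ closed (suc j) 0 l
closed-first j l = Σ∞-telescope t₁ t₂ α termwise α-zero α-small
  where
  open ≈-Reasoning
  t₁ = term j l 0
  t₂ = term (suc j) 0 l
  α : ℕ → PS
  α n = sgn n ⊛ mono (E j l 0 n) ⊛ y (n + j) ⊛ vanishing n
  α-zero : α 0 ≈ zeroPS
  α-zero = R.trans (R.*-congˡ vanishing-zero) (R.zeroʳ _)
  α-small : ∀ n → O[ n ] (α n)
  α-small n = O-⊛ˡ (O-⊛ˡ (O-⊛ʳ (sgn n) (O-mono-≤ (n≤E j l 0 n))))
  termwise : ∀ n → t₁ n ≈ t₂ n ⊕ (α n ⊝ α (suc n))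
  termwise n = begin
    s ⊛ (c n ⊛ Y) ⊛ (A ⊛ (𝟙 ⊕ w) ⊝ mono (D j l 0 n) ⊛ (𝟙 ⊕ o))
      ≈⟨ R.*-congˡ (R.+-congˡ (R.-‿cong (R.*-congʳ (mono-cong-+ _ _ (D-last j l n))))) ⟩
    s ⊛ (c n ⊛ Y) ⊛ (A ⊛ (𝟙 ⊕ w) ⊝ A ⊛ w ⊛ (𝟙 ⊕ o))
      ≈⟨ solve 6 (λ s c Y A w o → s :* (c :* Y) :* (A :* (:1 :+ w) :- A :* w :* (:1 :+ o)) := s :* (c :* Y) :* A :* (:1 :- o :* w)) R.refl s (c n) Y A w o ⟩
    s ⊛ (c n ⊛ Y) ⊛ A ⊛ (𝟙 ⊝ o ⊛ w)
      ≈⟨ R.*-congˡ (R.+-congˡ (R.-‿cong (R.trans (R.sym (mono-+ (odd n) (odd (n + j)))) (mono-cong-+ _ _ (odd+odd n j))))) ⟩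
    s ⊛ (c n ⊛ Y) ⊛ A ⊛ (𝟙 ⊝ u ⊛ v)
      -- Splits 1 - uv as u(1 - v) + (1 - u), one part for each of the two recurrences.
      ≈⟨ solve 6 (λ s c Y A u v → s :* (c :* Y) :* A :* (:1 :- u :* v) := s :* c :* (A :* u) :* ((:1 :- v) :* Y) :+ s :* A :* Y :* ((:1 :- u) :* c)) R.refl s (c n) Y A u v ⟩
    s ⊛ c n ⊛ (A ⊛ u) ⊛ ((𝟙 ⊝ v) ⊛ Y) ⊕ α n
      ≈⟨ R.+-congʳ (R.*-cong (R.*-congˡ (mono-cong-+ _ _ (E-first j l n))) (y-rec′ n j)) ⟨
    s ⊛ c n ⊛ mono (E (suc j) 0 l n) ⊛ ((𝟙 ⊕ w′) ⊛ Y′) ⊕ α n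
      ≈⟨ solve 8 (λ s c B w Y a Z o → s :* c :* B :* ((:1 :+ w) :* Y) :+ a := s :* (c :* Y) :* (B :* (:1 :+ w) :- Z :* (:1 :+ o))
           :+ (a :- (:- s) :* Z :* Y :* ((:1 :+ o) :* c))) R.refl s (c n) (mono (E (suc j) 0 l n)) w′ Y′ (α n) Z o ⟩
    s ⊛ (c n ⊛ Y′) ⊛ (mono (E (suc j) 0 l n) ⊛ (𝟙 ⊕ w′) ⊝ Z ⊛ (𝟙 ⊕ o)) ⊕ (α n ⊝ (⊖ s) ⊛ Z ⊛ Y′ ⊛ ((𝟙 ⊕ o) ⊛ c n))
      ≈⟨ R.+-cong (R.*-congˡ (R.+-congˡ (R.-‿cong (R.*-congʳ (mono-≡ (D-first j l n)))))) (R.+-congˡ (R.-‿cong next)) ⟨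
    t₂ n ⊕ (α n ⊝ α (suc n)) ∎
    where
    s = sgn n
    Y = y (n + j)
    Y′ = y (n + suc j)
    A = mono (E j l 0 n)
    Z = mono (E j l 0 (suc n))
    u = mono (n + n)
    v = mono (even (n + j))
    w = mono (odd (n + j))
    w′ = mono (odd (n + suc j))
    o = mono (odd n)
    next : α (suc n) ≈ (⊖ s) ⊛ Z ⊛ Y′ ⊛ ((𝟙 ⊕ o) ⊛ c n)
    next = R.*-cong (R.*-congˡ (R.reflexive (cong y (sym (ℕₚ.+-suc n j))))) (c-rec n)

Σ∞-cong : ∀ {f g} → (∀ n → f n ≈ g n) → Σ∞ f ≈ Σ∞ g
Σ∞-cong e = mk≈ λ t → at< (Σ<-cong[] {N = suc t} (suc t) (λ s _ → ≈⇒≈[] (e s))) t ℕₚ.≤-refl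

-- At j = 0 the factor 1 + q^{2n+1} is common to both halves of a term, so `c-y` pulls out F and
-- leaves the paired theta terms.
closed-base : ∀ l m → Gbase (suc (l + m)) (suc l) ≈ closed 0 l m
closed-base l m = begin
  Gbase (suc (l + m)) (suc l)    ≈⟨ Gbase≈F⊛Σψ ⟩
  F ⊛ Σ∞ ψ                       ≈⟨ Σ∞-⊛ F (O-ψ (O-mono-≤ (s≤s z≤n)) (O-mono-≤ (s≤s z≤n))) ⟩
  Σ∞ (λ n → F ⊛ ψ n)             ≈⟨ Σ∞-cong (λ n → R.sym (term≈ n)) ⟩
  closed 0 l m                   ∎
  where
  open ≈-Reasoning
  open Base l m
  ϑ-a : ∀ n → ϑ (mono (odd a)) n ≈ sgn n ⊛ mono (E 0 l m n)
  ϑ-a zero    = R.sym (R.trans (R.*-identityˡ _) (R.trans (mono-≡ (E-zero 0 l m)) mono-0))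
  ϑ-a (suc n) = begin
    ⊖ (P ^ n ⊛ mono (odd a) ⊛ ϑ (mono (odd a)) n)
      ≈⟨ R.-‿cong (R.*-cong (R.trans (R.*-congʳ (P^≈mono n)) (R.sym (mono-+ (n * modulus) (odd a)))) (ϑ-a n)) ⟩
    ⊖ (mono (n * modulus + odd a) ⊛ (sgn n ⊛ mono (E 0 l m n)))
      ≈⟨ solve 3 (λ x s z → :- (x :* (s :* z)) := (:- s) :* (x :* z)) R.refl _ _ _ ⟩
    (⊖ sgn n) ⊛ (mono (n * modulus + odd a) ⊛ mono (E 0 l m n))
      ≈⟨ R.*-congˡ (mono-cong-+ _ _ (sym (E-theta l m n))) ⟨
    sgn (suc n) ⊛ mono (E 0 l m (suc n)) ∎
  ϑ-b : ∀ n → ϑ (mono (odd b)) (suc n) ≈ ⊖ (sgn n ⊛ mono (D 0 l m n))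
  ϑ-b zero    = R.-‿cong (R.trans (solve 1 (λ x → :1 :* x :* :1 := :1 :* x) R.refl _) (R.*-congˡ (mono-≡ (D-theta-zero l m))))
  ϑ-b (suc n) = begin
    ⊖ (P ^ suc n ⊛ mono (odd b) ⊛ ϑ (mono (odd b)) (suc n))
      ≈⟨ R.-‿cong (R.*-cong (R.trans (R.*-congʳ (P^≈mono (suc n))) (R.sym (mono-+ (suc n * modulus) (odd b)))) (ϑ-b n)) ⟩
    ⊖ (mono (suc n * modulus + odd b) ⊛ (⊖ (sgn n ⊛ mono (D 0 l m n))))
      ≈⟨ solve 3 (λ x s z → :- (x :* (:- (s :* z))) := :- ((:- s) :* (x :* z))) R.refl _ _ _ ⟩
    ⊖ ((⊖ sgn n) ⊛ (mono (suc n * modulus + odd b) ⊛ mono (D 0 l m n)))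
      ≈⟨ R.-‿cong (R.*-congˡ (mono-cong-+ _ _ (sym (D-theta l m n)))) ⟨
    ⊖ (sgn (suc n) ⊛ mono (D 0 l m (suc n))) ∎
  term≈ : ∀ n → term 0 l m n ≈ F ⊛ ψ n
  term≈ n = begin
    sgn n ⊛ (c n ⊛ y (n + 0)) ⊛ (mono (E 0 l m n) ⊛ 1+q^ odd (n + 0) ⊝ mono (D 0 l m n) ⊛ 1+q^ odd n)
      ≡⟨ cong (λ x → sgn n ⊛ (c n ⊛ y x) ⊛ (mono (E 0 l m n) ⊛ 1+q^ odd x ⊝ mono (D 0 l m n) ⊛ 1+q^ odd n)) (ℕₚ.+-identityʳ n) ⟩
    sgn n ⊛ (c n ⊛ y n) ⊛ (mono (E 0 l m n) ⊛ 1+q^ odd n ⊝ mono (D 0 l m n) ⊛ 1+q^ odd n)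
      ≈⟨ solve 6 (λ s c Y x z o → s :* (c :* Y) :* (x :* o :- z :* o) := c :* (o :* Y) :* (s :* x :+ :- (s :* z))) R.refl _ _ _ _ _ _ ⟩
    c n ⊛ (1+q^ odd n ⊛ y n) ⊛ (sgn n ⊛ mono (E 0 l m n) ⊕ ⊖ (sgn n ⊛ mono (D 0 l m n)))
      ≈⟨ R.*-cong (R.sym (c-y n)) (R.+-cong (ϑ-a n) (ϑ-b n)) ⟨
    F ⊛ ψ n ∎

Σ<-head : ∀ {N f} → (∀ n → O[ N ] (f (suc n))) → ∀ n → Σ< (suc n) f ≈[ N ] f 0
Σ<-head e zero    = ≈⇒≈[] (R.+-identityˡ _)
Σ<-head e (suc n) = trans[] (⊕-cong[] (Σ<-head e n) (e n)) (≈⇒≈[] (R.+-identityʳ _))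

-- Only the leading half of the term n = 0 survives modulo q^{2j}: there E = 0, and y_j is 1 to this
-- precision.
closed≈𝟙 : ∀ j l m → closed j l m ≈[ j + j ] 𝟙
closed≈𝟙 j l m = trans[] (mk≈[] λ t l<N → at< (Σ<-head later t) t l<N) first-term
  where
  open ≈[]-Reasoning (j + j)
  later : ∀ n → O[ j + j ] (term j l m (suc n))
  later n = O-⊛ʳ _ (O-⊝ (O-⊛ˡ (O-mono-≤ (j+j≤E j l m n))) (O-⊛ˡ (O-mono-≤ (j+j≤D j l m (suc n)))))
  first-term : term j l m 0 ≈[ j + j ] 𝟙
  first-term = begin
    𝟙 ⊛ (𝟙 ⊛ y j) ⊛ (mono (E j l m 0) ⊛ 1+q^ odd j ⊝ mono (D j l m 0) ⊛ 1+q^ odd 0)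
      ≈⟨ ⊛-cong[] (⊛-cong[] refl[] (⊛-cong[] refl[] (≈[]-weaken (ℕₚ.n≤1+n _) (y≈𝟙 j))))
           (⊕-cong[] (⊛-cong[] (≈⇒≈[] (R.trans (mono-≡ (E-zero j l m)) mono-0)) (1+O (O-mono-≤ (ℕₚ.n≤1+n _)))) (⊖-cong[] (O-⊛ˡ (O-mono-≤ (j+j≤D j l m 0))))) ⟩
    𝟙 ⊛ (𝟙 ⊛ 𝟙) ⊛ (𝟙 ⊛ 𝟙 ⊝ zeroPS)
      ≈⟨ ≈⇒≈[] (R.trans (R.*-congˡ (R.trans (R.+-congˡ ⊖-zero) (R.+-identityʳ _))) (solve 0 (:1 :* (:1 :* :1) :* (:1 :* :1) := :1) R.refl)) ⟩
    𝟙 ∎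

-- Laurent series and matrices

embed-cong : ∀ {f g} → f ≈ g → ∀ z → embed f z ≡ embed g z
embed-cong e (+ n)    = at e n
embed-cong e -[1+ n ] = refl

embed-⊕ : ∀ f g z → embed (f ⊕ g) z ≡ embed f z ℤ.+ embed g z
embed-⊕ f g (+ n)    = ⊕-at f g n
embed-⊕ f g -[1+ n ] = refl

embed-O : ∀ {e f} → O[ e ] f → ∀ z → z ℤ.< + e → embed f z ≡ + 0
embed-O small (+ n)    z<e = at< small n (ℤₚ.drop‿+<+ z<e)
embed-O small -[1+ n ] z<e = refl

-- For negative z the shifted index lies below e, where the product has no coefficients; so the
-- shift undoes the multiplication on all of ℤ.
embed-mono : ∀ e f z → embed (mono e ⊛ f) (z ℤ.+ + e) ≡ embed f z
embed-mono e f (+ n)    = trans (cong (mono e ⊛ f) (ℕₚ.+-comm n e)) (mono-⊛-+ e f n)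
embed-mono e f -[1+ n ] = embed-O (O-⊛ˡ (O-mono e)) (-[1+ n ] ℤ.+ + e)
  (subst (-[1+ n ] ℤ.+ + e ℤ.<_) (ℤₚ.+-identityˡ (+ e)) (ℤₚ.+-monoˡ-< (+ e) ℤ.-<+))

suc-lead : ∀ j a → suc (lead j a) ≡ 2 * suc j * suc a
suc-lead = e
  where
  e : ∀ j a → suc (2 * j * suc a + suc (a + a)) ≡ 2 * suc j * suc a
  e = solve-∀

divided-difference : ∀ e e′ {f₁ f₂ f₃ f₄} → suc e ≡ e′ → f₁ ≈ f₂ ⊕ (mono (suc e) ⊛ f₃ ⊕ mono e ⊛ f₄) → ∀ z →
  divq e′ (embed f₁ -ₗ embed f₂) z ℤ.- divq 1 (embed f₄) z ≡ embed f₃ z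
divided-difference e .(suc e) {f₁} {f₂} {f₃} {f₄} refl rel z = begin
  embed f₁ w ℤ.- embed f₂ w ℤ.- embed f₄ (z ℤ.+ + 1)
    ≡⟨ cong (λ x → x ℤ.- embed f₂ w ℤ.- embed f₄ (z ℤ.+ + 1)) expand ⟩
  embed f₂ w ℤ.+ (embed f₃ z ℤ.+ embed f₄ (z ℤ.+ + 1)) ℤ.- embed f₂ w ℤ.- embed f₄ (z ℤ.+ + 1)
    ≡⟨ ℤS.solve 3 (λ a b c → a ℤS.:+ (b ℤS.:+ c) ℤS.:- a ℤS.:- c ℤS.:= b) refl (embed f₂ w) (embed f₃ z) (embed f₄ (z ℤ.+ + 1)) ⟩
  embed f₃ z ∎
  where
  open ≡-Reasoning
  module ℤS = ℤSolver.+-*-Solver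
  w = z ℤ.+ + suc e
  expand : embed f₁ w ≡ embed f₂ w ℤ.+ (embed f₃ z ℤ.+ embed f₄ (z ℤ.+ + 1))
  expand = trans (embed-cong rel w) (trans (embed-⊕ f₂ _ w) (cong (λ x → embed f₂ w ℤ.+ x)
    (trans (embed-⊕ (mono (suc e) ⊛ f₃) (mono e ⊛ f₄) w) (cong₂ ℤ._+_ (embed-mono (suc e) f₃ z)
      (trans (cong (embed (mono e ⊛ f₄)) (sym (ℤₚ.+-assoc z (+ 1) (+ e)))) (embed-mono e f₄ (z ℤ.+ + 1)))))))

-- Induction on j, and within a block on l. The equation for k is a hypothesis because l and m vary
-- while k stays fixed; the references to the preceding block exchange l and m.
block≡closed : ∀ k j l m → k ≡ suc (l + m) → ∀ z → block k j (suc l) z ≡ embed (closed j l m) z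
block≡closed k zero    l m refl z = embed-cong (closed-base l m) z
block≡closed k (suc j) l m k≡ z = inner≡closed l m k≡ z
  where
  inner≡closed : ∀ l m → k ≡ suc (l + m) → ∀ z → inner k (suc j) (block k j) (suc l) z ≡ embed (closed (suc j) l m) z
  inner≡closed zero m refl z = trans (block≡closed k j m 0 (cong suc (sym (ℕₚ.+-identityʳ m))) z) (embed-cong (closed-first j m) z)
  inner≡closed (suc a) m refl z = trans
    (cong₂ ℤ._-_ (cong₂ ℤ._-_ (lower z′) (upper z′)) (inner≡closed a (suc m) (cong suc (sym (ℕₚ.+-suc a m))) (z ℤ.+ + 1)))
    (divided-difference (lead j a) e (suc-lead j a) (closed-rec j a m) z)
    where
    e = 2 * suc j * suc a
    z′ = z ℤ.+ + e
    lower : ∀ z → block k j (a + m ∸ a + 1) z ≡ embed (closed j m (suc a)) z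
    lower z rewrite ℕₚ.m+n∸m≡n a m | ℕₚ.+-comm m 1 = block≡closed k j m (suc a) (cong suc (ℕₚ.+-comm (suc a) m)) z
    upper : ∀ z → block k j (a + m ∸ a + 2) z ≡ embed (closed j (suc m) a) z
    upper z rewrite ℕₚ.m+n∸m≡n a m | ℕₚ.+-comm m 2 = block≡closed k j (suc m) a (cong (suc ∘ suc) (ℕₚ.+-comm a m)) z

G≡block : ∀ p j a → a < suc p → ∀ z → G (suc (suc p)) (suc (suc (a + suc j * suc p))) z ≡ block (suc (suc p)) (suc j) (suc (suc a)) z
G≡block p j a a<p z = trans (else-branch (dec-false (suc (suc N) ℕₚ.≤? k) (ℕₚ.<⇒≱ (s≤s (s≤s p<N)))))
  (cong₂ (λ q r → block k q r z) quotient (trans (cong (_+ 2) remainder) (ℕₚ.+-comm a 2)))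
  where
  k = suc (suc p)
  N = a + suc j * suc p
  p<N : p < N
  p<N = ℕₚ.≤-trans (ℕₚ.m≤m+n (suc p) (j * suc p)) (ℕₚ.m≤n+m _ a)
  else-branch : (suc (suc N) ≤ᵇ k) ≡ false → G k (suc (suc N)) z ≡ block k (N / suc p) (N % suc p + 2) z
  else-branch e rewrite e = refl
  quotient : N / suc p ≡ suc j
  quotient = trans (+-distrib-/-∣ʳ a (n∣m*n (suc j))) (cong₂ _+_ (m<n⇒m/n≡0 a<p) (m*n/n≡m (suc j) (suc p)))
  remainder : N % suc p ≡ a
  remainder = trans ([m+kn]%n≡m%n a (suc j) (suc p)) (m<n⇒m%n≡m a<p)

G≡closed : ∀ p J l m → suc p ≡ l + m → ∀ z → G (suc (suc p)) (suc p * J + suc l) z ≡ embed (closed J l m) z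
G≡closed p zero l m p≡ z
  rewrite ℕₚ.*-zeroʳ p | dec-true (suc l ℕₚ.≤? suc (suc p)) (s≤s (ℕₚ.≤-trans (ℕₚ.m≤m+n l m) (ℕₚ.≤-reflexive (sym p≡)))) =
  block≡closed (suc (suc p)) 0 l m (cong suc p≡) z
-- Here i = 1. `G` lets a new block start at i = 2, so this index is the last one of block J, and
-- `closed-first` raises its level.
G≡closed p (suc J) zero m refl z = trans
  (cong (λ x → G (suc (suc p)) x z) (e p J))
  (trans (G≡closed p J (suc p) 0 (cong suc (sym (ℕₚ.+-identityʳ p))) z) (embed-cong (closed-first J (suc p)) z))
  where
  e : ∀ p J → suc p * suc J + 1 ≡ suc p * J + suc (suc p)
  e = solve-∀
G≡closed p (suc J) (suc a) m p≡ z = trans (cong (λ x → G (suc (suc p)) x z) (e p J a))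
  (trans (G≡block p J a (ℕₚ.≤-trans (ℕₚ.m≤m+n (suc a) m) (ℕₚ.≤-reflexive (sym p≡))) z)
         (block≡closed (suc (suc p)) (suc J) (suc a) m (cong suc p≡) z))
  where
  e : ∀ p J a → suc p * suc J + suc (suc a) ≡ suc (suc (a + suc J * suc p))
  e = solve-∀

-- Matrix products and the limit

sumPS≈Σ< : ∀ n f → sumPS n f ≈ Σ< n (f ∘ suc)
sumPS≈Σ< zero    f = R.refl
sumPS≈Σ< (suc n) f = R.trans (mk≈ λ t → sym (⊕-at (sumPS n f) (f (suc n)) t)) (R.+-congʳ (sumPS≈Σ< n f))

Σ<-cong : ∀ n {f g} → (∀ s → s < n → f s ≈ g s) → Σ< n f ≈ Σ< n g
Σ<-cong n e = ≈[]⇒≈ λ N → Σ<-cong[] n (λ s l → ≈⇒≈[] (e s l))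

Σ<-O : ∀ {N} n {f} → (∀ s → O[ N ] (f s)) → O[ N ] (Σ< n f)
Σ<-O zero    e = refl[]
Σ<-O (suc n) e = O-⊕ (Σ<-O n e) (e n)

Σ<-0 : ∀ n {f} → (∀ s → s < n → f s ≈ zeroPS) → Σ< n f ≈ zeroPS
Σ<-0 zero    e = R.refl
Σ<-0 (suc n) e = R.trans (R.+-cong (Σ<-0 n (λ s l → e s (ℕₚ.m<n⇒m<1+n l))) (e n ℕₚ.≤-refl)) (R.+-identityˡ zeroPS)

Σ<-single : ∀ n f {a} → a < n → (∀ s → s < n → s ≢ a → f s ≈ zeroPS) → Σ< n f ≈ f a
Σ<-single (suc n) f {a} a<1+n e with a ℕₚ.≟ n
... | yes refl = R.trans (R.+-congʳ (Σ<-0 n (λ s l → e s (ℕₚ.m<n⇒m<1+n l) (ℕₚ.<⇒≢ l)))) (R.+-identityˡ (f n))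
... | no  a≢n  = R.trans (R.+-cong
  (Σ<-single n f (ℕₚ.≤∧≢⇒< (ℕₚ.≤-pred a<1+n) a≢n) (λ s l → e s (ℕₚ.m<n⇒m<1+n l)))
  (e n ℕₚ.≤-refl (λ n≡a → a≢n (sym n≡a)))) (R.+-identityʳ (f a))

Σ<-comm : ∀ m n (f : ℕ → ℕ → PS) → Σ< m (λ s → Σ< n (f s)) ≈ Σ< n (λ t → Σ< m (λ s → f s t))
Σ<-comm zero    n f = R.sym (Σ<-0 n (λ _ _ → R.refl))
Σ<-comm (suc m) n f = R.trans (R.+-congʳ (Σ<-comm m n f)) (R.sym (Σ<-⊕ n _ _))

Σ<-truncate : ∀ b d f → (∀ s → b ≤ s → f s ≈ zeroPS) → Σ< (b + d) f ≈ Σ< b f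
Σ<-truncate b zero    f e rewrite ℕₚ.+-identityʳ b = R.refl
Σ<-truncate b (suc d) f e rewrite ℕₚ.+-suc b d =
  R.trans (R.+-cong (Σ<-truncate b d f e) (e (b + d) (ℕₚ.m≤m+n b d))) (R.+-identityʳ _)

ind-true : ∀ {a b f} → a ≤ b → ind (a ≤ᵇ b) f ≈ f
ind-true {a} {b} a≤b rewrite dec-true (a ℕₚ.≤? b) a≤b = R.refl

ind-false : ∀ {a b f} → b < a → ind (a ≤ᵇ b) f ≈ zeroPS
ind-false {a} {b} b<a rewrite dec-false (a ℕₚ.≤? b) (ℕₚ.<⇒≱ b<a) = R.refl

Σ<-ind : ∀ b d (X v : ℕ → PS) → Σ< (b + d) (λ s → ind (suc s ≤ᵇ b) (X s) ⊛ v s) ≈ Σ< b (λ s → X s ⊛ v s)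
Σ<-ind b d X v = R.trans
  (Σ<-truncate b d _ (λ s b≤s → R.trans (R.*-congʳ (ind-false (s≤s b≤s))) (R.zeroˡ (v s))))
  (Σ<-cong b (λ s s<b → R.*-congʳ (ind-true s<b)))

idMat-diagonal : ∀ l → idMat (suc l) (suc l) ≈ 𝟙
idMat-diagonal l rewrite dec-true (l ℕₚ.≟ l) refl = onePS≈𝟙

idMat-off : ∀ {l s} → s ≢ l → idMat (suc l) (suc s) ≈ zeroPS
idMat-off {l} {s} s≢l rewrite dec-false (l ℕₚ.≟ s) (λ l≡s → s≢l (sym l≡s)) = R.refl

module Matrices (p : ℕ) where

  k : ℕ
  k = suc p

  -- The vector g_j of the overview, indexed from 0.
  v : ℕ → ℕ → PS
  v j s = closed j s (p ∸ s)

  v≡closed : ∀ j l m → p ≡ l + m → v j l ≈ closed j l m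
  v≡closed j l m refl = R.reflexive (cong (closed j l) (ℕₚ.m+n∸m≡n l m))

  diagonal above : ℕ → ℕ → PS
  diagonal j s = mono (2 * suc j * s)
  above j s = mono (2 * suc j * suc s ∸ 1)

  -- Row k − m of the matrix A'_{(j+1)}.
  v-rec : ∀ j x m → p ≡ x + m → v j x ≈ Σ< (suc m) (λ s → diagonal j s ⊛ v (suc j) s) ⊕ Σ< m (λ s → above j s ⊛ v (suc j) s)
  v-rec j x zero p≡ = begin
    v j x
      ≈⟨ v≡closed j x 0 p≡ ⟩
    closed j x 0
      ≈⟨ closed-first j x ⟩
    closed (suc j) 0 x
      ≈⟨ v≡closed (suc j) 0 x (trans p≡ (ℕₚ.+-identityʳ x)) ⟨
    v (suc j) 0
      ≈⟨ R.trans (R.+-identityʳ _) (R.trans (R.+-identityˡ _) (R.trans (R.*-congʳ (R.trans (mono-≡ (ℕₚ.*-zeroʳ (2 * suc j))) mono-0)) (R.*-identityˡ _))) ⟨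
    zeroPS ⊕ diagonal j 0 ⊛ v (suc j) 0 ⊕ zeroPS ∎
    where open ≈-Reasoning
  v-rec j x (suc a) p≡ = begin
    v j x
      ≈⟨ v≡closed j x (suc a) p≡ ⟩
    closed j x (suc a)
      ≈⟨ closed-rec j a x ⟩
    closed j (suc x) a ⊕ (mono (suc (lead j a)) ⊛ closed (suc j) (suc a) x ⊕ mono (lead j a) ⊛ closed (suc j) a (suc x))
      ≈⟨ R.+-cong (v≡closed j (suc x) a (trans p≡ (ℕₚ.+-suc x a)))
           (R.+-cong (R.*-cong (mono-≡ (sym (suc-lead j a))) (v≡closed (suc j) (suc a) x (trans p≡ (ℕₚ.+-comm x (suc a)))))
                     (R.*-cong (mono-≡ (cong (_∸ 1) (sym (suc-lead j a)))) (v≡closed (suc j) a (suc x) (trans p≡ (trans (ℕₚ.+-comm x (suc a)) (sym (ℕₚ.+-suc a x))))))) ⟨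
    v j (suc x) ⊕ (diagonal j (suc a) ⊛ v (suc j) (suc a) ⊕ above j a ⊛ v (suc j) a)
      ≈⟨ R.+-congʳ (v-rec j (suc x) a (trans p≡ (ℕₚ.+-suc x a))) ⟩
    Σ< (suc a) (λ s → diagonal j s ⊛ v (suc j) s) ⊕ Σ< a (λ s → above j s ⊛ v (suc j) s)
      ⊕ (diagonal j (suc a) ⊛ v (suc j) (suc a) ⊕ above j a ⊛ v (suc j) a)
      ≈⟨ solve 4 (λ s t d u → s :+ t :+ (d :+ u) := s :+ d :+ (t :+ u)) R.refl _ _ _ _ ⟩
    Σ< (suc (suc a)) (λ s → diagonal j s ⊛ v (suc j) s) ⊕ Σ< (suc a) (λ s → above j s ⊛ v (suc j) s) ∎
    where open ≈-Reasoning

  A'≈ : ∀ j x m → p ≡ x + m → ∀ s → A' k (suc j) (suc x) (suc s) ≈ ind (suc s ≤ᵇ suc m) (diagonal j s) ⊕ ind (suc s ≤ᵇ m) (above j s)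
  A'≈ j x m refl s rewrite ℕₚ.m+n∸m≡n x m | ℕₚ.+-comm m 1 = mk≈ λ t → sym (⊕-at _ _ t)

  -- The two sums of `v-rec` are the two bands of a row of the matrix; the indicators extend both to
  -- all k columns.
  A'-v : ∀ j x → x < k → v j x ≈ Σ< k (λ s → A' k (suc j) (suc x) (suc s) ⊛ v (suc j) s)
  A'-v j x (s≤s x≤p) = begin
    v j x
      ≈⟨ v-rec j x m p≡ ⟩
    Σ< (suc m) (λ s → diagonal j s ⊛ w s) ⊕ Σ< m (λ s → above j s ⊛ w s)
      ≈⟨ R.+-cong (Σ<-ind (suc m) x (diagonal j) w) (Σ<-ind m (suc x) (above j) w) ⟨
    Σ< (suc m + x) (λ s → i₁ s ⊛ w s) ⊕ Σ< (m + suc x) (λ s → i₂ s ⊛ w s)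
      ≈⟨ R.+-cong (Σ<-≡ (cong suc (trans (ℕₚ.+-comm m x) (sym p≡)))) (Σ<-≡ (trans (ℕₚ.+-comm m (suc x)) (cong suc (sym p≡)))) ⟩
    Σ< k (λ s → i₁ s ⊛ w s) ⊕ Σ< k (λ s → i₂ s ⊛ w s)
      ≈⟨ Σ<-⊕ k _ _ ⟨
    Σ< k (λ s → i₁ s ⊛ w s ⊕ i₂ s ⊛ w s)
      ≈⟨ Σ<-cong k (λ s _ → R.trans (R.*-congʳ (A'≈ j x m p≡ s)) (R.distribʳ (w s) (i₁ s) (i₂ s))) ⟨
    Σ< k (λ s → A' k (suc j) (suc x) (suc s) ⊛ w s) ∎
    where
    open ≈-Reasoning
    m = p ∸ x
    w = v (suc j)
    p≡ : p ≡ x + m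
    p≡ = sym (ℕₚ.m+[n∸m]≡n x≤p)
    i₁ i₂ : ℕ → PS
    i₁ s = ind (suc s ≤ᵇ suc m) (diagonal j s)
    i₂ s = ind (suc s ≤ᵇ m) (above j s)
    Σ<-≡ : ∀ {a b f} → a ≡ b → Σ< a f ≈ Σ< b f
    Σ<-≡ refl = R.refl

  hprod-suc : ∀ J d i s → hprod k J (suc d) i s ≈ Σ< k (λ r → hprod k J d i (suc r) ⊛ A' k (J + suc d) (suc r) s)
  hprod-suc J d i s = R.trans (sumPS≈Σ< k _) (Σ<-cong k (λ r _ → mk≈ λ t → sym (⊛-at _ _ t)))

  hprod-v : ∀ J d l → l < k → v J l ≈ Σ< k (λ s → hprod k J d (suc l) (suc s) ⊛ v (J + d) s)
  hprod-v J zero l l<k = R.sym (begin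
    Σ< k (λ s → idMat (suc l) (suc s) ⊛ v (J + 0) s)   ≈⟨ Σ<-single k _ l<k (λ s _ s≢l → R.trans (R.*-congʳ (idMat-off s≢l)) (R.zeroˡ _)) ⟩
    idMat (suc l) (suc l) ⊛ v (J + 0) l                ≈⟨ R.trans (R.*-congʳ (idMat-diagonal l)) (R.*-identityˡ _) ⟩
    v (J + 0) l                                        ≡⟨ cong (λ j → v j l) (ℕₚ.+-identityʳ J) ⟩
    v J l                                              ∎)
    where open ≈-Reasoning
  hprod-v J (suc d) l l<k = begin
    v J l
      ≈⟨ hprod-v J d l l<k ⟩
    Σ< k (λ r → H r ⊛ v (J + d) r)
      ≈⟨ Σ<-cong k (λ r r<k → R.trans (R.*-congˡ (A'-v (J + d) r r<k)) (Σ<-⊛ k (H r) _)) ⟩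
    Σ< k (λ r → Σ< k (λ s → H r ⊛ (A' k (suc (J + d)) (suc r) (suc s) ⊛ v (suc (J + d)) s)))
      ≈⟨ Σ<-comm k k _ ⟩
    Σ< k (λ s → Σ< k (λ r → H r ⊛ (A' k (suc (J + d)) (suc r) (suc s) ⊛ v (suc (J + d)) s)))
      ≡⟨ cong (λ j → Σ< k (λ s → Σ< k (λ r → H r ⊛ (A' k j (suc r) (suc s) ⊛ v j s)))) (sym (ℕₚ.+-suc J d)) ⟩
    Σ< k (λ s → Σ< k (λ r → H r ⊛ (A' k (J + suc d) (suc r) (suc s) ⊛ v (J + suc d) s)))
      ≈⟨ Σ<-cong k (λ s _ → R.trans (R.*-congʳ (hprod-suc J d (suc l) (suc s))) (R.trans (R.*-comm _ _) (R.trans (Σ<-⊛ k _ _)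
           (Σ<-cong k (λ r _ → solve 3 (λ w h a → w :* (h :* a) := h :* (a :* w)) R.refl _ _ _))))) ⟨
    Σ< k (λ s → hprod k J (suc d) (suc l) (suc s) ⊛ v (J + suc d) s) ∎
    where
    open ≈-Reasoning
    H = λ r → hprod k J d (suc l) (suc r)

  O-ind : ∀ {N} b {f} → O[ N ] f → O[ N ] (ind b f)
  O-ind true  e = e
  O-ind false e = refl[]

  O-A' : ∀ j r s → O[ suc j + suc j ] (A' k (suc j) r (suc (suc s)))
  O-A' j r s = trans[] (≈⇒≈[] (mk≈ λ t → sym (⊕-at _ _ t)))
    (O-⊕ (O-ind (suc (suc s) ≤ᵇ k ∸ r + 1) (O-mono-≤ (bound j s)))
         -- In column c ≥ 2 the exponent 2jc - 1 of the second band is at least 4j - 1, which for j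
         -- ≥ 1 exceeds 2j.
         (O-ind (suc (suc s) ≤ᵇ k ∸ r) (O-mono-≤ (ℕₚ.≤-trans (ℕₚ.∸-monoˡ-≤ 1 (bound′ j s)) ℕₚ.≤-refl))))
    where
    bound : ∀ j s → suc j + suc j ≤ 2 * suc j * suc s
    bound j s = ℕₚ.≤-trans (ℕₚ.m≤m+n _ (2 * suc j * s)) (ℕₚ.≤-reflexive (e j s))
      where
      e : ∀ j s → suc j + suc j + 2 * suc j * s ≡ 2 * suc j * suc s
      e = solve-∀
    bound′ : ∀ j s → suc (suc j + suc j) ≤ 2 * suc j * suc (suc s)
    bound′ j s = ℕₚ.≤-trans (ℕₚ.m≤m+n _ (2 * j + 1 + 2 * suc j * s)) (ℕₚ.≤-reflexive (e j s))
      where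
      e : ∀ j s → suc (suc j + suc j) + (2 * j + 1 + 2 * suc j * s) ≡ 2 * suc j * suc (suc s)
      e = solve-∀

  O-hprod : ∀ J d i s → O[ J + suc d + (J + suc d) ] (hprod k J (suc d) i (suc (suc s)))
  O-hprod J d i s = trans[] (≈⇒≈[] (hprod-suc J d i (suc (suc s)))) (Σ<-O k (λ r → O-⊛ʳ _ (entry r)))
    where
    entry : ∀ r → O[ J + suc d + (J + suc d) ] (A' k (J + suc d) (suc r) (suc (suc s)))
    entry r rewrite ℕₚ.+-suc J d = O-A' (J + d) (suc r) s

  -- At least one factor is required: the smallness of the other columns comes from the last matrix
  -- and fails for the identity.
  v≈hprod : ∀ J d l → l < k → v J l ≈[ J + suc d + (J + suc d) ] hprod k J (suc d) (suc l) 1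
  v≈hprod J d l l<k = begin
    v J l
      ≈⟨ ≈⇒≈[] (hprod-v J (suc d) l l<k) ⟩
    Σ< k (λ s → hprod k J (suc d) (suc l) (suc s) ⊛ v (J + suc d) s)
      ≈⟨ Σ<-head (λ s → O-⊛ˡ (O-hprod J d (suc l) s)) p ⟩
    hprod k J (suc d) (suc l) 1 ⊛ v (J + suc d) 0
      ≈⟨ ⊛-cong[] refl[] (closed≈𝟙 (J + suc d) 0 p) ⟩
    hprod k J (suc d) (suc l) 1 ⊛ 𝟙
      ≈⟨ ≈⇒≈[] (R.*-identityʳ _) ⟩
    hprod k J (suc d) (suc l) 1 ∎
    where open ≈[]-Reasoning (J + suc d + (J + suc d))

theorem5p2 : (k : ℕ) → 2 ≤ k → (J i : ℕ) → 1 ≤ i → i ≤ k →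
    ((n : ℕ) → G k ((k ∸ 1) * J + i) -[1+ n ] ≡ + 0)
    × IsLimit (λ j → h k J j i 1) (λ t → G k ((k ∸ 1) * J + i) (+ t))
theorem5p2 (suc (suc p)) (s≤s (s≤s _)) J (suc l) _ (s≤s l≤p) =
  (λ n → G≡closed p J l (suc p ∸ l) p≡ -[1+ n ]) , limit
  where
  open Matrices (suc p)
  p≡ : suc p ≡ l + (suc p ∸ l)
  p≡ = sym (ℕₚ.m+[n∸m]≡n l≤p)
  agree : ∀ t j → J + suc t ≤ j → h (suc (suc p)) J j (suc l) 1 t ≡ G (suc (suc p)) (suc p * J + suc l) (+ t)
  agree t j N≤j with o , refl ← ℕₚ.m≤n⇒∃[o]m+o≡n N≤j
    rewrite ℕₚ.+-assoc J (suc t) o | ℕₚ.m+n∸m≡n J (suc (t + o)) =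
    trans (sym (at< (v≈hprod J (t + o) l (s≤s l≤p)) t
      (ℕₚ.<-≤-trans (s≤s (ℕₚ.m≤m+n t o)) (ℕₚ.≤-trans (ℕₚ.m≤n+m _ J) (ℕₚ.m≤m+n _ _)))))
      (sym (G≡closed p J l (suc p ∸ l) p≡ (+ t)))
  limit : IsLimit (λ j → h (suc (suc p)) J j (suc l) 1) (λ t → G (suc (suc p)) (suc p * J + suc l) (+ t))
  -- From this index on j > J, so the product has a factor, and 2j > t, so the congruence modulo
  -- q^{2j} covers the coefficient of q^t.
  limit t = J + suc t , agree t
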